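{- Let $k \ge 1$ be an integer and let $F$ be a satisfiable propositional CNF formula with $n$ variables, where $n > 2^k$. Let $R_F \subseteq \{0,1\}^n$ be the set of satisfying assignments (witnesses) of $F$, and assume that $\log_2 |R_F| - \frac{1}{k}\log_2 n$ is an integer. Then algorithm $\mathsf{UniWit}$ on inputs $F$ and $k$ succeeds (i.e. does not return $\bot$) with probability at least $\frac{1}{8}$.
   Context: **Hash families.** For integers $n, m, r$ let $H(n,m,r)$ denote a family of $r$-wise independent hash functions from $\{0,1\}^n$ to $\{0,1\}^m$: if $h$ is chosen uniformly at random from $H(n,m,r)$, then for all $\alpha_1,\dots,\alpha_r \in \{0,1\}^m$ and all distinct $y_1,\dots,y_r \in \{0,1\}^n$, $\Pr\left[\bigwedge_{i=1}^r h(y_i)=\alpha_i\right] = 2^{ -mr}$. For $m=0$, $\{0,1\}^0$ is a one-point set and $h$ is the constant map. A number $r$ with $2 \le r \le 2^n$ and the families $H(n,m,r)$ ($0 \le m \le n$) are fixed in advance. **BoundedSAT.** $\mathsf{BoundedSAT}(G, t)$ takes a propositional formula $G$ (a conjunction of a CNF formula and xor constraints, or more generally any constraint on the variables) and an integer $t \ge 0$, and returns a set $S$ of witnesses of $G$ with $|S| = \min(t, \#G)$, where $\#G$ is the number of all witnesses of $G$. **Algorithm $\mathsf{UniWit}(F,k)$.** Input: a CNF formula $F$ with variables $z_1,\dots,z_n$ and an integer $k \ge 1$. Output: a witness of $F$ or the failure symbol $\bot$. All random choices are uniform over the indicated sets and mutually independent. 1. $\mathrm{pivot} \leftarrow \lceil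 2n^{1/k} \rceil$; $S \leftarrow \mathsf{BoundedSAT}(F, \mathrm{pivot}+1)$. 2. If $|S| \le \mathrm{pivot}$: let $y_1,\dots,y_{|S|}$ be the elements of $S$; choose $j$ at random from $\{1,\dots,|S|\}$ and return $y_j$. 3. Otherwise: set $l \leftarrow \lfloor \frac{1}{k}\log_2 n \rfloor$ and $i \leftarrow l-1$, and repeat the following: - $i \leftarrow i+1$; - choose $h$ at random from $H(n, i-l, r)$; - choose $\alpha$ at random from $\{0,1\}^{i-l}$; - $S \leftarrow \mathsf{BoundedSAT}\big(F \wedge (h(z_1,\dots,z_n)=\alpha),\ \mathrm{pivot}+1\big)$; until ($1 \le |S| \le \mathrm{pivot}$) or ($i = n$). 4. After the loop: if $|S| > \mathrm{pivot}$ or $|S| < 1$, return $\bot$. Otherwise let $y_1,\dots,y_{|S|}$ be the elements of $S$ and choose $j$ at random from $\{1,\dots,\mathrm{pivot}\}$; if $j \le |S|$ return $y_j$, else return $\bot$. -}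

module Defs where

open import Data.Bool.Base using (Bool; true; false; not; _∧_; if_then_else_; T)
open import Data.Bool.ListAction using (any; all)
import Data.Bool.Properties as Bool
open import Data.Fin.Base using (Fin; toℕ; fromℕ<)
open import Data.Fin.Properties using (all?)
open import Data.Integer.Base using (+_)
open import Data.List.Base as List using (List; []; _∷_; length)
open import Data.List.Relation.Unary.All using (All)
open import Data.List.Relation.Unary.Unique.Propositional using (Unique)
open import Data.Maybe.Base using (Maybe; just; nothing)
open import Data.Nat.Base
  using (ℕ; zero; suc; _+_; _*_; _∸_; _^_; _⊓_; _≤_; _<_; z≤n; s≤s; NonZero; >-nonZero)
open import Data.Nat.Properties
open import Data.Product.Base using (∃-syntax)
open import Data.Rational.Base as ℚ using (ℚ; 0ℚ; 1ℚ)
import Data.Rational.Properties as ℚ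
open import Algebra.Properties.CommutativeMonoid.Sum ℚ.+-0-commutativeMonoid using (sum)
open import Data.Vec.Base as Vec using (Vec; []; _∷_)
import Data.Vec.Properties as Vec
open import Function.Base using (_∘_)
open import Function.Definitions using (Injective)
open import Relation.Binary.Definitions using (DecidableEquality)
open import Relation.Binary.PropositionalEquality using (_≡_; refl; sym; trans; cong; subst)
open import Relation.Nullary using (yes; no; does; contradiction; _×-dec_)
open import Relation.Unary using (Pred; Decidable)
open import Level using (0ℓ)

------------------------------------------------------------------------
-- Finite randomised computations

-- `draw N f` draws an element of `Fin N` uniformly, independently of all
-- earlier draws, and continues with `f`.
data Rand (A : Set) : Set where
  return : A → Rand A
  draw   : (N : ℕ) → .{{NonZero N}} → (Fin N → Rand A) → Rand A

infixl 1 _>>=_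

_>>=_ : {A B : Set} → Rand A → (A → Rand B) → Rand B
return a >>= g = g a
draw N f >>= g = draw N (λ i → f i >>= g)

-- The image of a uniformly random index under `f`.
uniform : {A : Set} {N : ℕ} → .{{NonZero N}} → (Fin N → A) → Rand A
uniform {N = N} f = draw N (return ∘ f)

Pr : {A : Set} → (A → Bool) → Rand A → ℚ
Pr E (return a) = if E a then 1ℚ else 0ℚ
Pr E (draw N f) = (+ 1 ℚ./ N) ℚ.* sum (λ i → Pr E (f i))

------------------------------------------------------------------------
-- Bit vectors

Bits : ℕ → Set
Bits = Vec Bool

_≟ᴮ_ : ∀ {m} → DecidableEquality (Bits m)
_≟ᴮ_ = Vec.≡-dec Bool._≟_

allBits : ∀ m → Vec (Bits m) (2 ^ m)
allBits zero    = [] ∷ []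
allBits (suc m) =
  Vec.concat (Vec.map (λ b → Vec.map (b ∷_) (allBits m)) (false ∷ true ∷ []))

uniformBits : ∀ m → Rand (Bits m)
uniformBits m = uniform {{m^n≢0 2 m}} (Vec.lookup (allBits m))

------------------------------------------------------------------------
-- Formulas and constraints

data Literal (n : ℕ) : Set where
  pos neg : Fin n → Literal n

Clause : ℕ → Set
Clause n = List (Literal n)

CNF : ℕ → Set
CNF n = List (Clause n)

evalLiteral : ∀ {n} → Bits n → Literal n → Bool
evalLiteral z (pos i) = Vec.lookup z i
evalLiteral z (neg i) = not (Vec.lookup z i)

evalClause : ∀ {n} → Bits n → Clause n → Bool
evalClause z = any (evalLiteral z)

Constraint : ℕ → Set
Constraint n = Bits n → Bool

⟦_⟧ : ∀ {n} → CNF n → Constraint n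
⟦ F ⟧ z = all (evalClause z) F

Satisfiable : ∀ {n} → Constraint n → Set
Satisfiable G = ∃[ z ] T (G z)

-- The number of witnesses.
# : ∀ {n} → Constraint n → ℕ
# {n} G = Vec.countᵇ G (allBits n)

-- The constraint G(z) ∧ (h(z) = α).
restrict : ∀ {n m} → Constraint n → (Bits n → Bits m) → Bits m → Constraint n
restrict G h α z = G z ∧ does (h z ≟ᴮ α)

------------------------------------------------------------------------
-- Hash families and the bounded solver

-- The indexed presentation allows a function to occur several times.
record HashFamily (n m r : ℕ) : Set where
  field
    size        : ℕ
    {{size≢0}}  : NonZero size
    hash        : Fin size → Bits n → Bits m
    independent : (α : Fin r → Bits m) (y : Fin r → Bits n) → Injective _≡_ _≡_ y →
                  Pr (λ h → does (all? (λ i → h (y i) ≟ᴮ α i))) (uniform hash)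
                    ≡ (+ 1 ℚ./ (2 ^ (m * r))) {{m^n≢0 2 (m * r)}}

  random : Rand (Bits n → Bits m)
  random = uniform hash

-- The returned sets are duplicate-free lists, whose order is the
-- enumeration y₁, …, y_|S| of the set.
record BoundedSAT (n : ℕ) : Set where
  field
    solve  : Constraint n → ℕ → List (Bits n)
    sound  : ∀ G t → All (T ∘ G) (solve G t)
    unique : ∀ G t → Unique (solve G t)
    card   : ∀ G t → length (solve G t) ≡ t ⊓ # G

------------------------------------------------------------------------
-- Rounded roots and logarithms

-- The least p ≤ b with P p, or b if there is none.
least : {P : Pred ℕ 0ℓ} → Decidable P → ℕ → ℕ
least P? zero    = zero
least P? (suc b) = if does (P? 0) then 0 else suc (least (P? ∘ suc) b)

-- The greatest p ≤ b with P p, or 0 if there is none.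
greatest : {P : Pred ℕ 0ℓ} → Decidable P → ℕ → ℕ
greatest P? zero    = zero
greatest P? (suc b) = if does (P? (suc b)) then suc b else greatest P? b

-- ⌈ 2 n^(1/k) ⌉, using 2 n^(1/k) ≤ p ⇔ 2ᵏ n ≤ pᵏ for k ≥ 1.
pivot : (n k : ℕ) → ℕ
pivot n k = least (λ p → 2 ^ k * n ≤? p ^ k) (2 * n)

-- ⌊ (1/k) log₂ n ⌋, using l ≤ (1/k) log₂ n ⇔ 2^(k l) ≤ n for k, n ≥ 1.
start : (n k : ℕ) → ℕ
start n k = greatest (λ l → 2 ^ (k * l) ≤? n) n

least-holds : {P : Pred ℕ 0ℓ} (P? : Decidable P) → ∀ b → P b → P (least P? b)
least-holds P? zero    Pb = Pb
least-holds P? (suc b) Pb with P? 0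
... | yes P0 = P0
... | no  _  = least-holds (P? ∘ suc) b Pb

least-minimal : {P : Pred ℕ 0ℓ} (P? : Decidable P) → ∀ b q → P q → least P? b ≤ q
least-minimal P? zero    q       Pq = z≤n
least-minimal P? (suc b) q       Pq with P? 0
least-minimal P? (suc b) q       Pq | yes _  = z≤n
least-minimal P? (suc b) zero    Pq | no ¬P0 = contradiction Pq ¬P0
least-minimal P? (suc b) (suc q) Pq | no _   = s≤s (least-minimal (P? ∘ suc) b q Pq)

greatest-≤ : {P : Pred ℕ 0ℓ} (P? : Decidable P) → ∀ b → greatest P? b ≤ b
greatest-≤ P? zero    = z≤n
greatest-≤ P? (suc b) with P? (suc b)
... | yes _ = ≤-refl
... | no  _ = m≤n⇒m≤1+n (greatest-≤ P? b)

greatest-holds : {P : Pred ℕ 0ℓ} (P? : Decidable P) → ∀ b → P 0 → P (greatest P? b)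
greatest-holds P? zero    P0 = P0
greatest-holds P? (suc b) P0 with P? (suc b)
... | yes Pb = Pb
... | no  _  = greatest-holds P? b P0

greatest-maximal : {P : Pred ℕ 0ℓ} (P? : Decidable P) →
                   ∀ b q → q ≤ b → P q → q ≤ greatest P? b
greatest-maximal P? zero    q q≤b Pq = q≤b
greatest-maximal {P} P? (suc b) q q≤b Pq with P? (suc b)
... | yes _  = q≤b
... | no ¬Pb = greatest-maximal P? b q (≤-pred (≤∧≢⇒< q≤b λ q≡b → ¬Pb (subst P q≡b Pq))) Pq

private
  *-^-distrib : ∀ a b k → a ^ k * b ^ k ≡ (a * b) ^ k
  *-^-distrib a b zero    = refl
  *-^-distrib a b (suc k) =
    trans ([m*n]*[o*p]≡[m*o]*[n*p] a (a ^ k) b (b ^ k)) (cong (a * b *_) (*-^-distrib a b k))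

  m≤m^1+k : ∀ m k → m ≤ m ^ suc k
  m≤m^1+k zero    k = z≤n
  m≤m^1+k (suc m) k = m≤m*n (suc m) (suc m ^ k) {{m^n≢0 (suc m) k}}

  n<2^n : ∀ n → n < 2 ^ n
  n<2^n zero    = s≤s z≤n
  n<2^n (suc n) =
    +-mono-≤ (m^n>0 2 n) (≤-trans (n<2^n n) (≤-reflexive (sym (+-identityʳ (2 ^ n)))))

pivot-holds : ∀ n k → 1 ≤ k → 2 ^ k * n ≤ pivot n k ^ k
pivot-holds n (suc k) _ = least-holds (λ p → 2 ^ suc k * n ≤? p ^ suc k) (2 * n)
  (≤-trans (*-monoʳ-≤ (2 ^ suc k) (m≤m^1+k n k)) (≤-reflexive (*-^-distrib 2 n (suc k))))

pivot-minimal : ∀ n k p → 2 ^ k * n ≤ p ^ k → pivot n k ≤ p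
pivot-minimal n k = least-minimal (λ p → 2 ^ k * n ≤? p ^ k) (2 * n)

start-≤ : ∀ n k → start n k ≤ n
start-≤ n k = greatest-≤ (λ l → 2 ^ (k * l) ≤? n) n

start-holds : ∀ n k → 1 ≤ n → 2 ^ (k * start n k) ≤ n
start-holds n k 1≤n = greatest-holds (λ l → 2 ^ (k * l) ≤? n) n
  (≤-trans (≤-reflexive (cong (2 ^_) (*-zeroʳ k))) 1≤n)

start-maximal : ∀ n k l → 1 ≤ k → 2 ^ (k * l) ≤ n → l ≤ start n k
start-maximal n (suc k) l _ 2^kl≤n = greatest-maximal (λ l → 2 ^ (suc k * l) ≤? n) n l
  (≤-trans (m≤n*m l (suc k)) (≤-trans (<⇒≤ (n<2^n (suc k * l))) 2^kl≤n)) 2^kl≤n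

-- For x, y, k ≥ 1: log₂ x − (1/k) log₂ y is an integer c.  Writing
-- c = a − b, this says x · 2ᵇ = 2ᵃ · y^(1/k), here raised to the power k.
LogDifferenceIsInteger : (x k y : ℕ) → Set
LogDifferenceIsInteger x k y = ∃[ a ] ∃[ b ] (x * 2 ^ b) ^ k ≡ (2 ^ a) ^ k * y

------------------------------------------------------------------------
-- The algorithm

module _ {n r : ℕ} (H : ∀ m → .(m ≤ n) → HashFamily n m r) (B : BoundedSAT n)
         (F : CNF n) (k : ℕ) where

  open BoundedSAT B using (solve)

  private
    p l : ℕ
    p = pivot n k
    l = start n k

  -- A uniformly random element; the empty list is reached only if F is
  -- unsatisfiable, where the algorithm is unspecified.
  pick : List (Bits n) → Rand (Maybe (Bits n))
  pick []         = return nothing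
  pick S@(_ ∷ _) = uniform (just ∘ List.lookup S)

  -- The (0-based) j-th element, or failure if there is none.
  element : List (Bits n) → ℕ → Maybe (Bits n)
  element S j with j <? length S
  ... | yes j<|S| = just (List.lookup S (fromℕ< j<|S|))
  ... | no  _     = nothing

  inRange? : List (Bits n) → Bool
  inRange? S = does (1 ≤? length S ×-dec length S ≤? p)

  finish : List (Bits n) → Rand (Maybe (Bits n))
  finish S with 1 ≤? length S | length S ≤? p
  ... | yes 1≤|S| | yes |S|≤p =
          uniform {N = p} {{>-nonZero (≤-trans 1≤|S| |S|≤p)}} (element S ∘ toℕ)
  ... | _         | _         = return nothing

  -- `loop d i` is the iteration with counter i, so that d = n − i further
  -- ones may follow; `until` tests the exit condition on the set it found.
  loop  : (d i : ℕ) → .(i + d ≡ n) → Rand (Maybe (Bits n))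
  until : (d i : ℕ) → .(i + d ≡ n) → List (Bits n) → Rand (Maybe (Bits n))

  loop d i i+d≡n =
    HashFamily.random
      (H (i ∸ l) (≤-trans (m∸n≤m i l) (≤-trans (m≤m+n i d) (≤-reflexive i+d≡n)))) >>= λ h →
    uniformBits (i ∸ l) >>= λ α →
    until d i i+d≡n (solve (restrict ⟦ F ⟧ h α) (p + 1))

  until zero    i i+d≡n S = finish S
  until (suc d) i i+d≡n S =
    if inRange? S then finish S else loop d (suc i) (trans (sym (+-suc i d)) i+d≡n)

  UniWit : Rand (Maybe (Bits n))
  UniWit =
    if does (length S ≤? p) then pick S else loop (n ∸ l) l (m+[n∸m]≡n (start-≤ n k))
    where
    S : List (Bits n)
    S = solve ⟦ F ⟧ (p + 1)

{-# OPTIONS --safe #-}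

-- Let X be the number of witnesses.  If X exceeds the pivot, the integrality assumption makes
-- μ = n^(1/k) an integer, so that pivot = 2μ and X = 2ᶜμ for some c.  In the iteration with m hash
-- bits the number Z of surviving witnesses has, by pairwise independence, mean M = 2ᶜ⁻ᵐμ and variance
-- at most M.  The probability v of success from this iteration on is the mean of a function of Z that
-- equals Z / 2μ for 1 ≤ Z ≤ 2μ and the corresponding probability v′ of the next iteration otherwise.
--   * For m = c this function is at least Z (2μ + 1 − Z) / 4μ², whose mean is at least 1/4.
--   * For m < c put D = 2ᶜ⁻ᵐ.  If v′ ≥ 1/8 + 1/4D, then the function is at least
--     1/8 + 1/4D − (Z − M)² / 8D²μ, whence v ≥ 1/8 + 1/8D.
-- By induction every iteration up to m = c has v ≥ 1/8 + 1/8D.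
module Submission where

open import Defs
open import Data.Integer.Base using (+_)
open import Data.Maybe.Base using (is-just)
open import Data.Nat.Base as ℕ using (ℕ)
open import Data.Rational.Base as ℚ using ()

open import Algebra.Bundles using (CommutativeRing)
open import Data.Bool.Base using (Bool; true; false; _∧_; if_then_else_; T)
open import Data.Fin.Base using (Fin; zero; suc; toℕ)
open import Data.Fin.Properties using (all?; any?)
import Data.Integer.Base as ℤ
import Data.Integer.Properties as ℤ
open import Data.List.Base as List using (List; _∷_; length)
open import Data.Maybe.Base using (Maybe; just)
open import Data.Nat.Divisibility
  using (_∣_; divides; 1∣_; ∣-trans; m∣m*n; *-monoʳ-∣; *-cancelˡ-∣)
open import Data.Nat.Primality using (Prime; euclidsLemma; prime[2])
import Data.Nat.Properties as ℕ
open import Data.Nat.Tactic.RingSolver using (solve-∀)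
open import Data.Product.Base using (_×_; _,_; ∃-syntax; proj₁; proj₂)
import Data.Rational.Properties as ℚ
open import Data.Rational.Solver using (module +-*-Solver)
open import Data.Rational.Unnormalised.Base as ℚᵘ using (mkℚᵘ; *≡*; *≤*)
import Data.Rational.Unnormalised.Properties as ℚᵘ
open import Data.Sum.Base using (_⊎_; inj₁; inj₂; [_,_]′)
open import Data.Vec.Base as Vec using (Vec; []; _∷_)
import Data.Vec.Functional as F
import Data.Vec.Properties as Vec
open import Function.Base using (_∘_; id)
open import Function.Definitions using (Injective)
open import Relation.Binary.PropositionalEquality
open import Relation.Nullary using (yes; no; does; contradiction; ¬?; ¬_; _×-dec_)
open import Relation.Nullary.Decidable using (dec-true; dec-false)

-- Powers, integer roots and quadratic inequalities over the naturals.

module Arithmetic where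

  open import Data.Nat.Base
  open import Data.Nat.Properties

  ^-distribʳ-* : ∀ k a b → (a * b) ^ k ≡ a ^ k * b ^ k
  ^-distribʳ-* zero    a b = refl
  ^-distribʳ-* (suc k) a b =
    trans (cong (a * b *_) (^-distribʳ-* k a b)) ([m*n]*[o*p]≡[m*o]*[n*p] a b (a ^ k) (b ^ k))

  ^-cancelˡ-≤ : ∀ k .{{_ : NonZero k}} {a b} → a ^ k ≤ b ^ k → a ≤ b
  ^-cancelˡ-≤ k aᵏ≤bᵏ = ≮⇒≥ λ b<a → <⇒≱ (^-monoˡ-< k b<a) aᵏ≤bᵏ

  prime∣^ : ∀ {p} → Prime p → ∀ k {e} → p ∣ e ^ k → p ∣ e
  prime∣^ pr zero    p∣1 = ∣-trans p∣1 (1∣ _)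
  prime∣^ pr (suc k) {e} p∣ = [ id , prime∣^ pr k ]′ (euclidsLemma e (e ^ k) pr p∣)

  -- Factors of two are removed one at a time: 2 divides a power of e and hence e, so e = 2 e′, and
  -- cancelling 2ᵏ leaves the same claim for a and e′.
  2^∣-root : ∀ k .{{_ : NonZero k}} a e → (2 ^ a) ^ k ∣ e ^ k → 2 ^ a ∣ e
  2^∣-root k           zero    e _ = 1∣ e
  2^∣-root k@(suc k-1) (suc a) e d∣
    with prime∣^ prime[2] k {e} (∣-trans (∣-trans (m∣m*n (2 ^ a)) (m∣m*n ((2 ^ suc a) ^ k-1))) d∣)
  ... | divides e′ refl = subst (2 ^ suc a ∣_) (*-comm 2 e′) (*-monoʳ-∣ 2 (2^∣-root k a e′
    (*-cancelˡ-∣ (2 ^ k) {{m^n≢0 2 k}} (subst₂ _∣_ (^-distribʳ-* k 2 (2 ^ a))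
      (trans (cong (_^ k) (*-comm e′ 2)) (^-distribʳ-* k 2 e′)) d∣))))

  -- What the analysis of the loop uses: `c` is the number of hash bits at which a cell has `μ`
  -- elements on average, and `l+c≤n` places that iteration within the loop. In `scale`, `μ` is the
  -- k-th root of n.
  record Scale (n k X : ℕ) : Set where
    field
      μ c      : ℕ
      X≡       : X ≡ 2 ^ c * μ
      pivot≡2μ : pivot n k ≡ 2 * μ
      1≤μ      : 1 ≤ μ
      l+c≤n    : start n k + c ≤ n

  -- By assumption n has a rational k-th root, with a power of two as denominator; being the root of
  -- an integer, it is an integer μ.
  scale : ∀ {n k X} → 1 ≤ k → 1 ≤ n → LogDifferenceIsInteger X k n → X ≤ 2 ^ n →
          pivot n k < X → Scale n k X
  scale {n} {k@(suc _)} {X} 1≤k 1≤n (a , b , eq) X≤2ⁿ p<X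
    -- By `eq`, (2ᵃ)ᵏ divides (X 2ᵇ)ᵏ with quotient n, so 2ᵃ divides X 2ᵇ; the quotient `μ` then
    -- satisfies μᵏ = n.
    with 2^∣-root k a (X * 2 ^ b) (divides n (trans eq (*-comm ((2 ^ a) ^ k) n)))
  ... | divides μ Xb≡ = record
    { μ = μ ; c = a ∸ b ; X≡ = X≡ ; pivot≡2μ = p≡ ; 1≤μ = 1≤μ ; l+c≤n = l+c≤n }
    where
    instance
      2^a≢0 = m^n≢0 2 a
      2^b≢0 = m^n≢0 2 b
      2^ak≢0 = m^n≢0 (2 ^ a) k
    μᵏ≡n : μ ^ k ≡ n
    μᵏ≡n = *-cancelˡ-≡ (μ ^ k) n ((2 ^ a) ^ k) (begin-equality
      (2 ^ a) ^ k * μ ^ k   ≡⟨ *-comm ((2 ^ a) ^ k) (μ ^ k) ⟩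
      μ ^ k * (2 ^ a) ^ k   ≡⟨ ^-distribʳ-* k μ (2 ^ a) ⟨
      (μ * 2 ^ a) ^ k       ≡⟨ cong (_^ k) Xb≡ ⟨
      (X * 2 ^ b) ^ k       ≡⟨ eq ⟩
      (2 ^ a) ^ k * n       ∎)
      where open ≤-Reasoning hiding (start)
    2μᵏ≡ : 2 ^ k * n ≡ (2 * μ) ^ k
    2μᵏ≡ = trans (cong (2 ^ k *_) (sym μᵏ≡n)) (sym (^-distribʳ-* k 2 μ))
    p≡ : pivot n k ≡ 2 * μ
    p≡ = ≤-antisym (pivot-minimal n k (2 * μ) (≤-reflexive 2μᵏ≡))
      (^-cancelˡ-≤ k (≤-trans (≤-reflexive (sym 2μᵏ≡)) (pivot-holds n k 1≤k)))
    1≤μ : 1 ≤ μ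
    1≤μ = ^-cancelˡ-≤ k (≤-trans (≤-reflexive (^-zeroˡ k)) (≤-trans 1≤n (≤-reflexive (sym μᵏ≡n))))
    μ<X : μ < X
    μ<X = ≤-<-trans (≤-trans (m≤n*m μ 2) (≤-reflexive (sym p≡))) p<X
    b≤a : b ≤ a
    -- Since X 2ᵇ = μ 2ᵃ, a < b would force X ≤ μ, but μ ≤ 2μ = pivot < X. So `a ∸ b` is the true
    -- difference.
    b≤a = ≮⇒≥ λ a<b → <-irrefl (sym Xb≡) (begin-strict
      μ * 2 ^ a   ≤⟨ *-monoʳ-≤ μ (^-monoʳ-≤ 2 (<⇒≤ a<b)) ⟩
      μ * 2 ^ b   <⟨ *-monoˡ-< (2 ^ b) μ<X ⟩
      X * 2 ^ b   ∎)
      where open ≤-Reasoning hiding (start)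
    X≡ : X ≡ 2 ^ (a ∸ b) * μ
    X≡ = *-cancelʳ-≡ X _ (2 ^ b) (begin-equality
      X * 2 ^ b                    ≡⟨ Xb≡ ⟩
      μ * 2 ^ a                    ≡⟨ cong (λ e → μ * 2 ^ e) (m∸n+n≡m b≤a) ⟨
      μ * 2 ^ (a ∸ b + b)          ≡⟨ cong (μ *_) (^-distribˡ-+-* 2 (a ∸ b) b) ⟩
      μ * (2 ^ (a ∸ b) * 2 ^ b)    ≡⟨ *-assoc μ _ _ ⟨
      μ * 2 ^ (a ∸ b) * 2 ^ b      ≡⟨ cong (_* 2 ^ b) (*-comm μ _) ⟩
      2 ^ (a ∸ b) * μ * 2 ^ b      ∎)
      where open ≤-Reasoning hiding (start)
    2^l≤μ : 2 ^ start n k ≤ μ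
    2^l≤μ = ^-cancelˡ-≤ k (begin
      (2 ^ start n k) ^ k   ≡⟨ ^-*-assoc 2 (start n k) k ⟩
      2 ^ (start n k * k)   ≡⟨ cong (2 ^_) (*-comm (start n k) k) ⟩
      2 ^ (k * start n k)   ≤⟨ start-holds n k 1≤n ⟩
      n                     ≡⟨ μᵏ≡n ⟨
      μ ^ k                 ∎)
      where open ≤-Reasoning hiding (start)
    -- With 2^l ≤ μ, the power 2^(l + c) is at most 2^c μ = X ≤ 2^n.
    l+c≤n : start n k + (a ∸ b) ≤ n
    l+c≤n = ≮⇒≥ λ n<l+c → <⇒≱ (^-monoʳ-< 2 (s≤s (s≤s z≤n)) n<l+c) (begin
      2 ^ (start n k + (a ∸ b))       ≡⟨ ^-distribˡ-+-* 2 (start n k) (a ∸ b) ⟩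
      2 ^ start n k * 2 ^ (a ∸ b)     ≤⟨ *-monoˡ-≤ (2 ^ (a ∸ b)) 2^l≤μ ⟩
      μ * 2 ^ (a ∸ b)                 ≡⟨ *-comm μ _ ⟩
      2 ^ (a ∸ b) * μ                 ≡⟨ X≡ ⟨
      X                               ≤⟨ X≤2ⁿ ⟩
      2 ^ n                           ∎)
      where open ≤-Reasoning hiding (start)

  -- This is (x - y)² ≥ 0. To avoid subtraction the larger number is written as the smaller plus d;
  -- the slack is d².
  amgm : ∀ x y → 2 * x * y ≤ x * x + y * y
  amgm x y with ≤-total x y
  ... | inj₁ x≤y = go x≤y
    where
    go : ∀ {x y} → x ≤ y → 2 * x * y ≤ x * x + y * y
    go {x} x≤y with m≤n⇒∃[o]m+o≡n x≤y
    ... | d , refl = m+n≤o⇒m≤o _ {d * d} (≤-reflexive (eq x d))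
      where
      eq : ∀ x d → 2 * x * (x + d) + d * d ≡ x * x + (x + d) * (x + d)
      eq = solve-∀
  ... | inj₂ y≤x with m≤n⇒∃[o]m+o≡n y≤x
  ...   | d , refl = m+n≤o⇒m≤o _ {d * d} (≤-reflexive (eq y d))
      where
      eq : ∀ y d → 2 * (y + d) * y + d * d ≡ (y + d) * (y + d) + y * y
      eq = solve-∀

  -- The two quadratic bounds from the proof idea, for z in range, multiplied by 4μ² and by 8D²μ, and
  -- with terms moved so that no subtraction occurs.
  base-minorant : ∀ μ z → 1 ≤ z → (2 * μ + 1) * z ≤ 2 * μ * z + z * z
  base-minorant μ (suc z) _ = m+n≤o⇒m≤o _ {z * suc z} (≤-reflexive (eq μ z))
    where
    eq : ∀ μ z → (2 * μ + 1) * suc z + z * suc z ≡ 2 * μ * suc z + suc z * suc z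
    eq = solve-∀

  step-minorant : ∀ D μ z → 2 ≤ D → 1 ≤ z →
    (D * D + 2 * D) * μ + 2 * (D * μ) * z ≤ 4 * (D * D) * z + (z * z + D * μ * (D * μ))
  step-minorant D μ z 2≤D 1≤z with ≤-total μ z
  -- For μ ≤ z, 2D ≤ D² bounds the constant term by 2D²μ ≤ 4D²z, and `amgm` bounds the mixed term by
  -- the two squares.
  ... | inj₁ μ≤z = begin
    (D * D + 2 * D) * μ + 2 * (D * μ) * z
      ≤⟨ +-mono-≤ (*-monoˡ-≤ μ (+-monoʳ-≤ (D * D) (*-monoˡ-≤ D 2≤D))) (amgm (D * μ) z) ⟩
    (D * D + D * D) * μ + (D * μ * (D * μ) + z * z)
      ≤⟨ +-mono-≤ (*-mono-≤ (m+n≤o⇒m≤o (D * D + D * D) {2 * (D * D)} (≤-reflexive (eq D))) μ≤z)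
           (≤-reflexive (+-comm (D * μ * (D * μ)) (z * z))) ⟩
    4 * (D * D) * z + (z * z + D * μ * (D * μ)) ∎
    where
    open ≤-Reasoning hiding (start)
    eq : ∀ D → D * D + D * D + 2 * (D * D) ≡ 4 * (D * D)
    eq = solve-∀
  -- For z ≤ μ write μ = z + e and D = 1 + D′. Then Dμ - z = De + D′z, whose square contains D²e²;
  -- this absorbs the excess through 2e ≤ 1 + e² ≤ z + e².
  ... | inj₂ z≤μ with m≤n⇒∃[o]m+o≡n z≤μ | m≤n⇒∃[o]m+o≡n (≤-trans (s≤s z≤n) 2≤D)
  ...   | e , refl | D′ , refl = begin
    (D * D + 2 * D) * (z + e) + 2 * (D * (z + e)) * z
      ≤⟨ +-monoˡ-≤ (2 * (D * (z + e)) * z) (*-monoˡ-≤ (z + e) (+-monoʳ-≤ (D * D) (*-monoˡ-≤ D 2≤D))) ⟩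
    (D * D + D * D) * (z + e) + 2 * (D * (z + e)) * z
      ≡⟨ eq₁ D z e ⟩
    D * D * (2 * z + 2 * 1 * e) + 2 * (D * (z + e)) * z
      ≤⟨ +-monoˡ-≤ (2 * (D * (z + e)) * z) (*-monoʳ-≤ (D * D)
           (+-monoʳ-≤ (2 * z) (≤-trans (amgm 1 e) (+-monoˡ-≤ (e * e) 1≤z)))) ⟩
    D * D * (2 * z + (z + e * e)) + 2 * (D * (z + e)) * z
      ≤⟨ m+n≤o⇒m≤o _ {D * D * z + D′ * z * (D′ * z) + 2 * (D * e) * (D′ * z)} (≤-reflexive (eq₂ D′ z e)) ⟩
    4 * (D * D) * z + (z * z + D * (z + e) * (D * (z + e))) ∎
    where
    open ≤-Reasoning hiding (start)
    eq₁ : ∀ D z e → (D * D + D * D) * (z + e) + 2 * (D * (z + e)) * z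
                  ≡ D * D * (2 * z + 2 * 1 * e) + 2 * (D * (z + e)) * z
    eq₁ = solve-∀
    eq₂ : ∀ D′ z e → (1 + D′) * (1 + D′) * (2 * z + (z + e * e)) + 2 * ((1 + D′) * (z + e)) * z
                      + ((1 + D′) * (1 + D′) * z + D′ * z * (D′ * z) + 2 * ((1 + D′) * e) * (D′ * z))
                    ≡ 4 * ((1 + D′) * (1 + D′)) * z + (z * z + (1 + D′) * (z + e) * ((1 + D′) * (z + e)))
    eq₂ = solve-∀

open Arithmetic

-- The naturals inside the rationals, and finite sums.

module Probability where

  open import Data.Nat.Base using (zero; suc; NonZero; _^_; _∸_; _<_; z≤n; s≤s)
  open import Data.Nat.Properties using (_≤?_; _<?_)
  open import Data.Rational.Base using (ℚ; 0ℚ; 1ℚ; _/_; _+_; _*_; _≤_)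
  open import Algebra.Properties.Semiring.Sum (CommutativeRing.semiring ℚ.+-*-commutativeRing)
    using (sum; sum-cong-≗; ∑-comm; ∑-distrib-+; *-distribˡ-sum; *-distribʳ-sum)
  open +-*-Solver using (solve; _:+_; _:*_; _:=_; con)

  -- Opaque so that unification does not unfold the normalisation of fractions.
  opaque

    ι : ℕ → ℚ
    ι n = + n / 1

    toℚᵘ-ι : ∀ n → ℚ.toℚᵘ (ι n) ℚᵘ.≃ mkℚᵘ (+ n) 0
    toℚᵘ-ι n = ℚ.toℚᵘ-fromℚᵘ (mkℚᵘ (+ n) 0)

    ι-+ : ∀ m n → ι (m ℕ.+ n) ≡ ι m + ι n
    ι-+ m n = ℚ.toℚᵘ-injective (begin
      ℚ.toℚᵘ (ι (m ℕ.+ n))                ≈⟨ toℚᵘ-ι (m ℕ.+ n) ⟩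
      mkℚᵘ (+ (m ℕ.+ n)) 0                ≈⟨ *≡* (cong (ℤ._* + 1) (cong₂ ℤ._+_
                                               (sym (ℤ.*-identityʳ (+ m))) (sym (ℤ.*-identityʳ (+ n))))) ⟩
      mkℚᵘ (+ m) 0 ℚᵘ.+ mkℚᵘ (+ n) 0      ≈⟨ ℚᵘ.+-cong (toℚᵘ-ι m) (toℚᵘ-ι n) ⟨
      ℚ.toℚᵘ (ι m) ℚᵘ.+ ℚ.toℚᵘ (ι n)      ≈⟨ ℚ.toℚᵘ-homo-+ (ι m) (ι n) ⟨
      ℚ.toℚᵘ (ι m + ι n)                  ∎)
      where open import Relation.Binary.Reasoning.Setoid ℚᵘ.≃-setoid

    ι-* : ∀ m n → ι (m ℕ.* n) ≡ ι m * ι n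
    ι-* m n = ℚ.toℚᵘ-injective (begin
      ℚ.toℚᵘ (ι (m ℕ.* n))                ≈⟨ toℚᵘ-ι (m ℕ.* n) ⟩
      mkℚᵘ (+ (m ℕ.* n)) 0                ≈⟨ *≡* (cong (ℤ._* + 1) (ℤ.pos-* m n)) ⟩
      mkℚᵘ (+ m) 0 ℚᵘ.* mkℚᵘ (+ n) 0      ≈⟨ ℚᵘ.*-cong (toℚᵘ-ι m) (toℚᵘ-ι n) ⟨
      ℚ.toℚᵘ (ι m) ℚᵘ.* ℚ.toℚᵘ (ι n)      ≈⟨ ℚ.toℚᵘ-homo-* (ι m) (ι n) ⟨
      ℚ.toℚᵘ (ι m * ι n)                  ∎)
      where open import Relation.Binary.Reasoning.Setoid ℚᵘ.≃-setoid

    ι-mono-≤ : ∀ {m n} → m ℕ.≤ n → ι m ≤ ι n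
    ι-mono-≤ {m} {n} m≤n = ℚ.toℚᵘ-cancel-≤ (begin
      ℚ.toℚᵘ (ι m)   ≃⟨ toℚᵘ-ι m ⟩
      mkℚᵘ (+ m) 0   ≤⟨ *≤* (ℤ.*-monoʳ-≤-nonNeg (+ 1) (ℤ.+≤+ m≤n)) ⟩
      mkℚᵘ (+ n) 0   ≃⟨ toℚᵘ-ι n ⟨
      ℚ.toℚᵘ (ι n)   ∎)
      where open ℚᵘ.≤-Reasoning

    ι-cancel-≤ : ∀ {m n} → ι m ≤ ι n → m ℕ.≤ n
    ι-cancel-≤ {m} {n} ιm≤ιn = ℤ.drop‿+≤+ (ℤ.*-cancelʳ-≤-pos (+ m) (+ n) (+ 1) (ℚᵘ.drop-*≤* (begin
      mkℚᵘ (+ m) 0   ≃⟨ toℚᵘ-ι m ⟨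
      ℚ.toℚᵘ (ι m)   ≤⟨ ℚ.toℚᵘ-mono-≤ ιm≤ιn ⟩
      ℚ.toℚᵘ (ι n)   ≃⟨ toℚᵘ-ι n ⟩
      mkℚᵘ (+ n) 0   ∎)))
      where open ℚᵘ.≤-Reasoning

    ι-*-inverse : ∀ n .{{_ : NonZero n}} → ι n * (+ 1 / n) ≡ 1ℚ
    ι-*-inverse n@(suc k) = ℚ.toℚᵘ-injective (begin
      ℚ.toℚᵘ (ι n * (+ 1 / n))               ≈⟨ ℚ.toℚᵘ-homo-* (ι n) (+ 1 / n) ⟩
      ℚ.toℚᵘ (ι n) ℚᵘ.* ℚ.toℚᵘ (+ 1 / n)     ≈⟨ ℚᵘ.*-cong (toℚᵘ-ι n) (ℚ.toℚᵘ-fromℚᵘ (mkℚᵘ (+ 1) k)) ⟩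
      mkℚᵘ (+ n) 0 ℚᵘ.* mkℚᵘ (+ 1) k         ≈⟨ *≡* (trans (ℤ.*-identityʳ _) (trans (ℤ.*-identityʳ (+ n))
                                                  (sym (trans (ℤ.*-identityˡ _) (ℤ.*-identityˡ (+ n)))))) ⟩
      mkℚᵘ (+ 1) 0                           ∎)
      where open import Relation.Binary.Reasoning.Setoid ℚᵘ.≃-setoid

    ι-nonNeg : ∀ n → ℚ.NonNegative (ι n)
    ι-nonNeg n = ℚ.normalize-nonNeg n 1

    ι-pos : ∀ n .{{_ : NonZero n}} → ℚ.Positive (ι n)
    ι-pos n = ℚ.normalize-pos n 1

    ι-0 : ι 0 ≡ 0ℚ
    ι-0 = refl

    ι-1 : ι 1 ≡ 1ℚ
    ι-1 = refl

  1/n-nonNeg : ∀ n .{{_ : NonZero n}} → ℚ.NonNegative (+ 1 / n)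
  1/n-nonNeg n = ℚ.normalize-nonNeg 1 n

  sum-mono : ∀ {n} {f g : Fin n → ℚ} → (∀ i → f i ≤ g i) → sum f ≤ sum g
  sum-mono {zero}  f≤g = ℚ.≤-refl
  sum-mono {suc n} f≤g = ℚ.+-mono-≤ (f≤g zero) (sum-mono (f≤g ∘ suc))

  sum-const : ∀ n q → sum {n} (λ _ → q) ≡ ι n * q
  sum-const zero    q = sym (trans (cong (_* q) ι-0) (ℚ.*-zeroˡ q))
  sum-const (suc n) q = begin
    q + sum {n} (λ _ → q)  ≡⟨ cong (_+_ q) (sum-const n q) ⟩
    q + ι n * q            ≡⟨ solve 2 (λ x y → y :+ x :* y := (con 1ℚ :+ x) :* y) refl (ι n) q ⟩
    (1ℚ + ι n) * q         ≡⟨ cong (λ x → (x + ι n) * q) ι-1 ⟨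
    (ι 1 + ι n) * q        ≡⟨ cong (_* q) (ι-+ 1 n) ⟨
    ι (suc n) * q          ∎
    where open ≡-Reasoning

  -- Indicators and expectations of finite random computations.

  ⟨_⟩ : Bool → ℚ
  ⟨ b ⟩ = if b then 1ℚ else 0ℚ

  ⟨∧⟩ : ∀ a b → ⟨ a ∧ b ⟩ ≡ ⟨ a ⟩ * ⟨ b ⟩
  ⟨∧⟩ true  b = sym (ℚ.*-identityˡ ⟨ b ⟩)
  ⟨∧⟩ false b = sym (ℚ.*-zeroˡ ⟨ b ⟩)

  ⟨⟩-nonNeg : ∀ b → 0ℚ ≤ ⟨ b ⟩
  ⟨⟩-nonNeg true  = ℚ.nonNegative⁻¹ 1ℚ
  ⟨⟩-nonNeg false = ℚ.≤-refl

  -- The recursion of `Pr` with a rational-valued function in place of an event, so that moments and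
  -- linearity can be expressed.
  𝔼 : {A : Set} → Rand A → (A → ℚ) → ℚ
  𝔼 (return a) f = f a
  𝔼 (draw N g) f = (+ 1 / N) * sum (λ i → 𝔼 (g i) f)

  module _ {A : Set} where

    Pr-as-𝔼 : ∀ E (c : Rand A) → Pr E c ≡ 𝔼 c (⟨_⟩ ∘ E)
    Pr-as-𝔼 E (return a) = refl
    Pr-as-𝔼 E (draw N g) = cong ((+ 1 / N) *_) (sum-cong-≗ (λ i → Pr-as-𝔼 E (g i)))

    𝔼-cong : ∀ (c : Rand A) {f g} → (∀ a → f a ≡ g a) → 𝔼 c f ≡ 𝔼 c g
    𝔼-cong (return a) f≗g = f≗g a
    𝔼-cong (draw N h) f≗g = cong ((+ 1 / N) *_) (sum-cong-≗ (λ i → 𝔼-cong (h i) f≗g))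

    𝔼-mono : ∀ (c : Rand A) {f g} → (∀ a → f a ≤ g a) → 𝔼 c f ≤ 𝔼 c g
    𝔼-mono (return a) f≤g = f≤g a
    𝔼-mono (draw N h) f≤g =
      ℚ.*-monoˡ-≤-nonNeg (+ 1 / N) {{1/n-nonNeg N}} (sum-mono (λ i → 𝔼-mono (h i) f≤g))

    𝔼-+ : ∀ (c : Rand A) f g → 𝔼 c (λ a → f a + g a) ≡ 𝔼 c f + 𝔼 c g
    𝔼-+ (return a) f g = refl
    𝔼-+ (draw N h) f g = begin
      (+ 1 / N) * sum (λ i → 𝔼 (h i) (λ a → f a + g a))
        ≡⟨ cong ((+ 1 / N) *_) (sum-cong-≗ (λ i → 𝔼-+ (h i) f g)) ⟩
      (+ 1 / N) * sum (λ i → 𝔼 (h i) f + 𝔼 (h i) g)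
        ≡⟨ cong ((+ 1 / N) *_) (∑-distrib-+ (λ i → 𝔼 (h i) f) (λ i → 𝔼 (h i) g)) ⟩
      (+ 1 / N) * (sum (λ i → 𝔼 (h i) f) + sum (λ i → 𝔼 (h i) g))
        ≡⟨ ℚ.*-distribˡ-+ (+ 1 / N) _ _ ⟩
      𝔼 (draw N h) f + 𝔼 (draw N h) g ∎
      where open ≡-Reasoning

    𝔼-* : ∀ (c : Rand A) q f → 𝔼 c (λ a → q * f a) ≡ q * 𝔼 c f
    𝔼-* (return a) q f = refl
    𝔼-* (draw N h) q f = begin
      (+ 1 / N) * sum (λ i → 𝔼 (h i) (λ a → q * f a))
        ≡⟨ cong ((+ 1 / N) *_) (sum-cong-≗ (λ i → 𝔼-* (h i) q f)) ⟩
      (+ 1 / N) * sum (λ i → q * 𝔼 (h i) f)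
        ≡⟨ cong ((+ 1 / N) *_) (*-distribˡ-sum q (λ i → 𝔼 (h i) f)) ⟨
      (+ 1 / N) * (q * sum (λ i → 𝔼 (h i) f))
        ≡⟨ solve 3 (λ x y z → x :* (y :* z) := y :* (x :* z)) refl (+ 1 / N) q _ ⟩
      q * 𝔼 (draw N h) f ∎
      where open ≡-Reasoning

    𝔼-const : ∀ (c : Rand A) q → 𝔼 c (λ _ → q) ≡ q
    𝔼-const (return a) q = refl
    𝔼-const (draw N h) q = begin
      (+ 1 / N) * sum (λ i → 𝔼 (h i) (λ _ → q))  ≡⟨ cong ((+ 1 / N) *_) (sum-cong-≗ (λ i → 𝔼-const (h i) q)) ⟩
      (+ 1 / N) * sum {N} (λ i → q)               ≡⟨ cong ((+ 1 / N) *_) (sum-const N q) ⟩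
      (+ 1 / N) * (ι N * q)                       ≡⟨ solve 3 (λ x y z → x :* (y :* z) := (y :* x) :* z) refl (+ 1 / N) (ι N) q ⟩
      (ι N * (+ 1 / N)) * q                       ≡⟨ cong (_* q) (ι-*-inverse N) ⟩
      1ℚ * q                                      ≡⟨ ℚ.*-identityˡ q ⟩
      q                                           ∎
      where open ≡-Reasoning

    𝔼-sum : ∀ (c : Rand A) {n} (f : Fin n → A → ℚ) →
            𝔼 c (λ a → sum (λ i → f i a)) ≡ sum (λ i → 𝔼 c (f i))
    𝔼-sum c {zero}  f = 𝔼-const c 0ℚ
    𝔼-sum c {suc n} f =
      trans (𝔼-+ c (f zero) _) (cong (_+_ (𝔼 c (f zero))) (𝔼-sum c (f ∘ suc)))

    𝔼->>= : ∀ {B : Set} (c : Rand A) (k : A → Rand B) f → 𝔼 (c >>= k) f ≡ 𝔼 c (λ a → 𝔼 (k a) f)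
    𝔼->>= (return a) k f = refl
    𝔼->>= (draw N h) k f = cong ((+ 1 / N) *_) (sum-cong-≗ (λ i → 𝔼->>= (h i) k f))

  -- Fubini for finite averages; it allows averaging over the hash function with the target value
  -- fixed.
  𝔼-comm : ∀ {A B : Set} (c : Rand A) (d : Rand B) (f : A → B → ℚ) →
           𝔼 c (λ a → 𝔼 d (f a)) ≡ 𝔼 d (λ b → 𝔼 c (λ a → f a b))
  𝔼-comm (return a) d f = refl
  𝔼-comm (draw N h) d f = begin
    (+ 1 / N) * sum (λ i → 𝔼 (h i) (λ a → 𝔼 d (f a)))
      ≡⟨ cong ((+ 1 / N) *_) (sum-cong-≗ (λ i → 𝔼-comm (h i) d f)) ⟩
    (+ 1 / N) * sum (λ i → 𝔼 d (λ b → 𝔼 (h i) (λ a → f a b)))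
      ≡⟨ cong ((+ 1 / N) *_) (𝔼-sum d (λ i b → 𝔼 (h i) (λ a → f a b))) ⟨
    (+ 1 / N) * 𝔼 d (λ b → sum (λ i → 𝔼 (h i) (λ a → f a b)))
      ≡⟨ 𝔼-* d (+ 1 / N) _ ⟨
    𝔼 d (λ b → 𝔼 (draw N h) (λ a → f a b)) ∎
    where open ≡-Reasoning

  -- Powers of one half and sums over all bit vectors.

  ½^ : ℕ → ℚ
  ½^ k = (+ 1 / (2 ^ k)) {{ℕ.m^n≢0 2 k}}

  ½^-inverse : ∀ k → ι (2 ^ k) * ½^ k ≡ 1ℚ
  ½^-inverse k = ι-*-inverse (2 ^ k) {{ℕ.m^n≢0 2 k}}

  -- Uniqueness of inverses: multiplying by 1 = (2ʲ ½ʲ)(2ᵏ ½ᵏ) and regrouping cancels 2ʲ⁺ᵏ, without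
  -- computing any normalised fraction.
  ½^-+ : ∀ j k → ½^ (j ℕ.+ k) ≡ ½^ j * ½^ k
  ½^-+ j k = begin
    ½^ (j ℕ.+ k)
      ≡⟨ solve 1 (λ x → x := (con 1ℚ :* con 1ℚ) :* x) refl _ ⟩
    (1ℚ * 1ℚ) * ½^ (j ℕ.+ k)
      ≡⟨ cong₂ (λ x y → (x * y) * ½^ (j ℕ.+ k)) (½^-inverse j) (½^-inverse k) ⟨
    ((ι (2 ^ j) * ½^ j) * (ι (2 ^ k) * ½^ k)) * ½^ (j ℕ.+ k)
      ≡⟨ solve 5 (λ a b c d e → ((a :* b) :* (c :* d)) :* e := ((a :* c) :* e) :* (b :* d)) refl
           (ι (2 ^ j)) (½^ j) (ι (2 ^ k)) (½^ k) _ ⟩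
    ((ι (2 ^ j) * ι (2 ^ k)) * ½^ (j ℕ.+ k)) * (½^ j * ½^ k)
      ≡⟨ cong (λ x → (x * ½^ (j ℕ.+ k)) * (½^ j * ½^ k)) (ι-* (2 ^ j) (2 ^ k)) ⟨
    (ι (2 ^ j ℕ.* 2 ^ k) * ½^ (j ℕ.+ k)) * (½^ j * ½^ k)
      ≡⟨ cong (λ x → (ι x * ½^ (j ℕ.+ k)) * (½^ j * ½^ k)) (ℕ.^-distribˡ-+-* 2 j k) ⟨
    (ι (2 ^ (j ℕ.+ k)) * ½^ (j ℕ.+ k)) * (½^ j * ½^ k)
      ≡⟨ cong (_* (½^ j * ½^ k)) (½^-inverse (j ℕ.+ k)) ⟩
    1ℚ * (½^ j * ½^ k)
      ≡⟨ ℚ.*-identityˡ _ ⟩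
    ½^ j * ½^ k ∎
    where open ≡-Reasoning

  module _ {A : Set} where

    sum-lookup-++ : ∀ {k l} (f : A → ℚ) (xs : Vec A k) (ys : Vec A l) →
      sum (f ∘ Vec.lookup (xs Vec.++ ys)) ≡ sum (f ∘ Vec.lookup xs) + sum (f ∘ Vec.lookup ys)
    sum-lookup-++ f []       ys = sym (ℚ.+-identityˡ _)
    sum-lookup-++ f (x ∷ xs) ys =
      trans (cong (_+_ (f x)) (sum-lookup-++ f xs ys)) (sym (ℚ.+-assoc (f x) _ _))

    sum-lookup-map : ∀ {B : Set} {k} (f : A → ℚ) (g : B → A) (xs : Vec B k) →
      sum (f ∘ Vec.lookup (Vec.map g xs)) ≡ sum (f ∘ g ∘ Vec.lookup xs)
    sum-lookup-map f g []       = refl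
    sum-lookup-map f g (x ∷ xs) = cong (_+_ (f (g x))) (sum-lookup-map f g xs)

    countᵇ-as-sum : ∀ {k} (P : A → Bool) (xs : Vec A k) →
      ι (Vec.countᵇ P xs) ≡ sum (⟨_⟩ ∘ P ∘ Vec.lookup xs)
    countᵇ-as-sum P []       = ι-0
    countᵇ-as-sum P (x ∷ xs) with P x
    ... | true  = trans (ι-+ 1 _) (cong₂ _+_ ι-1 (countᵇ-as-sum P xs))
    ... | false = trans (countᵇ-as-sum P xs) (sym (ℚ.+-identityˡ _))

  Σᴮ : ∀ m → (Bits m → ℚ) → ℚ
  Σᴮ m f = sum (f ∘ Vec.lookup (allBits m))

  Σᴮ-suc : ∀ m f → Σᴮ (suc m) f ≡ Σᴮ m (f ∘ (false ∷_)) + Σᴮ m (f ∘ (true ∷_))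
  Σᴮ-suc m f = begin
    Σᴮ (suc m) f
      ≡⟨ sum-lookup-++ f (Vec.map (false ∷_) (allBits m)) _ ⟩
    sum (f ∘ Vec.lookup (Vec.map (false ∷_) (allBits m)))
      + sum (f ∘ Vec.lookup (Vec.map (true ∷_) (allBits m) Vec.++ []))
      ≡⟨ cong₂ _+_ (sum-lookup-map f (false ∷_) (allBits m))
           (trans (sum-lookup-++ f (Vec.map (true ∷_) (allBits m)) [])
             (trans (ℚ.+-identityʳ _) (sum-lookup-map f (true ∷_) (allBits m)))) ⟩
    Σᴮ m (f ∘ (false ∷_)) + Σᴮ m (f ∘ (true ∷_)) ∎
    where open ≡-Reasoning

  -- The form to which the half with the wrong first bit reduces in `Σᴮ-dirac`.
  Σᴮ-zero : ∀ m (f : Bits m → ℚ) → Σᴮ m (λ x → 0ℚ * f x) ≡ 0ℚ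
  Σᴮ-zero m f = trans (sym (*-distribˡ-sum 0ℚ (f ∘ Vec.lookup (allBits m)))) (ℚ.*-zeroˡ (Σᴮ m f))

  -- This expresses that `allBits` lists every vector exactly once. By induction, only the half of
  -- the enumeration with the first bit of y contributes.
  Σᴮ-dirac : ∀ {m} (y : Bits m) (f : Bits m → ℚ) → Σᴮ m (λ x → ⟨ does (y ≟ᴮ x) ⟩ * f x) ≡ f y
  Σᴮ-dirac []      f = trans (ℚ.+-identityʳ _) (ℚ.*-identityˡ (f []))
  Σᴮ-dirac {suc m} (false ∷ y) f = begin
    Σᴮ (suc m) (λ x → ⟨ does ((false ∷ y) ≟ᴮ x) ⟩ * f x)
      ≡⟨ Σᴮ-suc m (λ x → ⟨ does ((false ∷ y) ≟ᴮ x) ⟩ * f x) ⟩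
    Σᴮ m (λ x → ⟨ does (y ≟ᴮ x) ⟩ * f (false ∷ x)) + Σᴮ m (λ x → 0ℚ * f (true ∷ x))
      ≡⟨ cong₂ _+_ (Σᴮ-dirac y (f ∘ (false ∷_))) (Σᴮ-zero m (f ∘ (true ∷_))) ⟩
    f (false ∷ y) + 0ℚ
      ≡⟨ ℚ.+-identityʳ _ ⟩
    f (false ∷ y) ∎
    where open ≡-Reasoning
  Σᴮ-dirac {suc m} (true ∷ y) f = begin
    Σᴮ (suc m) (λ x → ⟨ does ((true ∷ y) ≟ᴮ x) ⟩ * f x)
      ≡⟨ Σᴮ-suc m (λ x → ⟨ does ((true ∷ y) ≟ᴮ x) ⟩ * f x) ⟩
    Σᴮ m (λ x → 0ℚ * f (false ∷ x)) + Σᴮ m (λ x → ⟨ does (y ≟ᴮ x) ⟩ * f (true ∷ x))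
      ≡⟨ cong₂ _+_ (Σᴮ-zero m (f ∘ (false ∷_))) (Σᴮ-dirac y (f ∘ (true ∷_))) ⟩
    0ℚ + f (true ∷ y)
      ≡⟨ ℚ.+-identityˡ _ ⟩
    f (true ∷ y) ∎
    where open ≡-Reasoning

  Σᴮ-≟ : ∀ {m} (y : Bits m) → Σᴮ m (λ x → ⟨ does (y ≟ᴮ x) ⟩) ≡ 1ℚ
  Σᴮ-≟ {m} y = trans
    (sum-cong-≗ (λ t → sym (ℚ.*-identityʳ ⟨ does (y ≟ᴮ Vec.lookup (allBits m) t) ⟩)))
    (Σᴮ-dirac y (λ _ → 1ℚ))

  Σᴮ-const : ∀ m q → Σᴮ m (λ _ → q) ≡ ι (2 ^ m) * q
  Σᴮ-const m = sum-const (2 ^ m)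

  -- Fresh points and lowering the degree of independence.

  sum-nonNeg : ∀ {k} {f : Fin k → ℚ} → (∀ i → 0ℚ ≤ f i) → 0ℚ ≤ sum f
  sum-nonNeg {k} 0≤f = ℚ.≤-trans
    (ℚ.≤-reflexive (sym (trans (sum-const k 0ℚ) (ℚ.*-zeroʳ (ι k))))) (sum-mono 0≤f)

  term≤sum : ∀ {k} {f : Fin k → ℚ} → (∀ i → 0ℚ ≤ f i) → ∀ i → f i ≤ sum f
  term≤sum {f = f} 0≤f zero    = ℚ.≤-trans (ℚ.≤-reflexive (sym (ℚ.+-identityʳ (f zero))))
    (ℚ.+-monoʳ-≤ (f zero) (sum-nonNeg (0≤f ∘ suc)))
  term≤sum {f = f} 0≤f (suc i) = ℚ.≤-trans (term≤sum (0≤f ∘ suc) i)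
    (ℚ.≤-trans (ℚ.≤-reflexive (sym (ℚ.+-identityˡ _))) (ℚ.+-monoˡ-≤ _ (0≤f zero)))


  -- Σᵢ [y i = x] would be at least 1 at every x, while it sums to r over all x.
  fresh : ∀ {n r} → r < 2 ^ n → (y : Fin r → Bits n) → ∃[ x ] ∀ i → y i ≢ x
  fresh {n} {r} r<2ⁿ y
    with any? (λ t → ¬? (any? (λ i → y i ≟ᴮ Vec.lookup (allBits n) t)))
  ... | yes (t , fresh) = Vec.lookup (allBits n) t , λ i yi≡x → fresh (i , yi≡x)
  ... | no ¬fresh = contradiction (ι-cancel-≤ bound) (ℕ.<⇒≱ r<2ⁿ)
    where
    open ℚ.≤-Reasoning
    covered : ∀ t → 1ℚ ≤ sum (λ i → ⟨ does (y i ≟ᴮ Vec.lookup (allBits n) t) ⟩)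
    covered t with any? (λ i → y i ≟ᴮ Vec.lookup (allBits n) t)
    ... | no  ¬hit      = contradiction (t , ¬hit) ¬fresh
    ... | yes (i , hit) = ℚ.≤-trans
      (ℚ.≤-reflexive (sym (cong ⟨_⟩ (dec-true (y i ≟ᴮ Vec.lookup (allBits n) t) hit))))
      (term≤sum (λ j → ⟨⟩-nonNeg (does (y j ≟ᴮ Vec.lookup (allBits n) t))) i)
    bound : ι (2 ^ n) ≤ ι r
    bound = begin
      ι (2 ^ n)
        ≡⟨ ℚ.*-identityʳ _ ⟨
      ι (2 ^ n) * 1ℚ
        ≡⟨ Σᴮ-const n 1ℚ ⟨
      Σᴮ n (λ _ → 1ℚ)
        ≤⟨ sum-mono covered ⟩
      Σᴮ n (λ x → sum (λ i → ⟨ does (y i ≟ᴮ x) ⟩))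
        ≡⟨ ∑-comm (λ t i → ⟨ does (y i ≟ᴮ Vec.lookup (allBits n) t) ⟩) ⟩
      sum (λ i → Σᴮ n (λ x → ⟨ does (y i ≟ᴮ x) ⟩))
        ≡⟨ sum-cong-≗ (λ i → Σᴮ-≟ (y i)) ⟩
      sum (λ (i : Fin r) → 1ℚ)
        ≡⟨ sum-const r 1ℚ ⟩
      ι r * 1ℚ
        ≡⟨ ℚ.*-identityʳ _ ⟩
      ι r ∎

  ∷-injective : ∀ {A : Set} {r} {x : A} {y : Fin r → A} → (∀ i → y i ≢ x) →
                Injective _≡_ _≡_ y → Injective _≡_ _≡_ (x F.∷ y)
  ∷-injective y≢x inj {zero}  {zero}  eq = refl
  ∷-injective y≢x inj {zero}  {suc j} eq = contradiction (sym eq) (y≢x j)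
  ∷-injective y≢x inj {suc i} {zero}  eq = contradiction eq (y≢x i)
  ∷-injective y≢x inj {suc i} {suc j} eq = cong suc (inj eq)

  module _ {n m : ℕ} where

    agree : ∀ {q} → (Fin q → Bits m) → (Fin q → Bits n) → (Bits n → Bits m) → Bool
    agree α y h = does (all? (λ i → h (y i) ≟ᴮ α i))

    -- The field `independent` restated as an expectation, with the degree q as a parameter so that
    -- it can be lowered.
    Independent : Rand (Bits n → Bits m) → ℕ → Set
    Independent c q = (α : Fin q → Bits m) (y : Fin q → Bits n) → Injective _≡_ _≡_ y →
                      𝔼 c (⟨_⟩ ∘ agree α y) ≡ ½^ (m ℕ.* q)

    -- Sum over the values of h at a fresh point.
    independent-pred : ∀ c {q} → q < 2 ^ n → Independent c (suc q) → Independent c q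
    independent-pred c {q} q<2ⁿ ind α y inj with fresh q<2ⁿ y
    ... | x , x-fresh = begin
      𝔼 c (⟨_⟩ ∘ agree α y)
        ≡⟨ 𝔼-cong c (λ h → Σᴮ-dirac (h x) (λ _ → ⟨ agree α y h ⟩)) ⟨
      𝔼 c (λ h → Σᴮ m (λ β → ⟨ does (h x ≟ᴮ β) ⟩ * ⟨ agree α y h ⟩))
        -- On families extended by `F.∷`, `agree` computes to a conjunction with the new point
        -- first, so `⟨∧⟩` applies as it stands.
        ≡⟨ 𝔼-cong c (λ h → sum-cong-≗ (λ t → ⟨∧⟩ (does (h x ≟ᴮ Vec.lookup (allBits m) t)) _)) ⟨
      𝔼 c (λ h → Σᴮ m (λ β → ⟨ agree (β F.∷ α) (x F.∷ y) h ⟩))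
        ≡⟨ 𝔼-sum c (λ t h → ⟨ agree (Vec.lookup (allBits m) t F.∷ α) (x F.∷ y) h ⟩) ⟩
      Σᴮ m (λ β → 𝔼 c (⟨_⟩ ∘ agree (β F.∷ α) (x F.∷ y)))
        ≡⟨ sum-cong-≗ (λ t → ind (Vec.lookup (allBits m) t F.∷ α) (x F.∷ y) (∷-injective x-fresh inj)) ⟩
      Σᴮ m (λ _ → ½^ (m ℕ.* suc q))
        ≡⟨ Σᴮ-const m _ ⟩
      ι (2 ^ m) * ½^ (m ℕ.* suc q)
        ≡⟨ cong (λ e → ι (2 ^ m) * ½^ e) (ℕ.*-suc m q) ⟩
      ι (2 ^ m) * ½^ (m ℕ.+ m ℕ.* q)
        ≡⟨ cong (ι (2 ^ m) *_) (½^-+ m (m ℕ.* q)) ⟩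
      ι (2 ^ m) * (½^ m * ½^ (m ℕ.* q))
        ≡⟨ ℚ.*-assoc (ι (2 ^ m)) (½^ m) _ ⟨
      ι (2 ^ m) * ½^ m * ½^ (m ℕ.* q)
        ≡⟨ cong (_* ½^ (m ℕ.* q)) (½^-inverse m) ⟩
      1ℚ * ½^ (m ℕ.* q)
        ≡⟨ ℚ.*-identityˡ _ ⟩
      ½^ (m ℕ.* q) ∎
      where open ≡-Reasoning

    -- The degree drops by one at a time; q + j ≤ 2ⁿ ensures that a fresh point exists at each
    -- stage.
    independent-≤ : ∀ c {q} j → q ℕ.+ j ℕ.≤ 2 ^ n → Independent c (q ℕ.+ j) → Independent c q
    independent-≤ c {q} zero    _      ind = subst (Independent c) (ℕ.+-identityʳ q) ind
    independent-≤ c {q} (suc j) q+j≤2ⁿ ind = independent-≤ c {q} j (ℕ.<⇒≤ q+j<2ⁿ)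
      (independent-pred c q+j<2ⁿ (subst (Independent c) (ℕ.+-suc q j) ind))
      where
      q+j<2ⁿ : q ℕ.+ j < 2 ^ n
      q+j<2ⁿ = subst (ℕ._≤ 2 ^ n) (ℕ.+-suc q j) q+j≤2ⁿ

    family-independent : ∀ {r} (H : HashFamily n m r) → Independent (HashFamily.random H) r
    family-independent H α y inj = trans
      (sym (Pr-as-𝔼 (agree α y) (HashFamily.random H))) (HashFamily.independent H α y inj)

    pairwise : ∀ c → Independent c 2 → ∀ {y y′} → y ≢ y′ → ∀ α α′ →
               𝔼 c (λ h → ⟨ does (h y ≟ᴮ α) ⟩ * ⟨ does (h y′ ≟ᴮ α′) ⟩) ≡ ½^ m * ½^ m
    pairwise c ind {y} {y′} y≢y′ α α′ = begin
      𝔼 c (λ h → ⟨ does (h y ≟ᴮ α) ⟩ * ⟨ does (h y′ ≟ᴮ α′) ⟩)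
        ≡⟨ 𝔼-cong c (λ h → split (does (h y ≟ᴮ α)) (does (h y′ ≟ᴮ α′))) ⟨
      𝔼 c (⟨_⟩ ∘ agree (α F.∷ α′ F.∷ F.[]) (y F.∷ y′ F.∷ F.[]))
        ≡⟨ ind (α F.∷ α′ F.∷ F.[]) (y F.∷ y′ F.∷ F.[])
             (∷-injective (λ { zero → y≢y′ ∘ sym }) (λ { {zero} {zero} _ → refl })) ⟩
      ½^ (m ℕ.* 2)
        ≡⟨ cong ½^ (trans (ℕ.*-comm m 2) (cong (m ℕ.+_) (ℕ.+-identityʳ m))) ⟩
      ½^ (m ℕ.+ m)
        ≡⟨ ½^-+ m m ⟩
      ½^ m * ½^ m ∎
      where
      open ≡-Reasoning
      -- `all?` over two indices ends in a trailing `true`, which reduces away only once b is known.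
      split : ∀ a b → ⟨ a ∧ b ∧ true ⟩ ≡ ⟨ a ⟩ * ⟨ b ⟩
      split a true  = ⟨∧⟩ a true
      split a false = ⟨∧⟩ a false

  -- First and second moments of the size of a random cell.

  sum-*-sum : ∀ {k l} (f : Fin k → ℚ) (g : Fin l → ℚ) →
              sum f * sum g ≡ sum (λ i → sum (λ j → f i * g j))
  sum-*-sum f g = trans (*-distribʳ-sum (sum g) f) (sum-cong-≗ (λ i → *-distribˡ-sum (f i) g))

  ⟨⟩-idem : ∀ b → ⟨ b ⟩ * ⟨ b ⟩ ≡ ⟨ b ⟩
  ⟨⟩-idem true  = ℚ.*-identityˡ 1ℚ
  ⟨⟩-idem false = ℚ.*-zeroˡ 0ℚ

  *-mono-nonNeg : ∀ {p q r} → 0ℚ ≤ p → q ≤ r → p * q ≤ p * r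
  *-mono-nonNeg {p} 0≤p q≤r = ℚ.*-monoˡ-≤-nonNeg p {{ℚ.nonNegative 0≤p}} q≤r

  module Cells {n m : ℕ} (c : Rand (Bits n → Bits m)) (independent : Independent c 2) (G : Constraint n) where

    -- The pair (h, α) stands for the preimage of α under h.
    Cell : Set
    Cell = (Bits n → Bits m) × Bits m

    -- Joins the two draws of an iteration, so that all moments refer to one distribution.
    randomCell : Rand Cell
    randomCell = c >>= λ h → uniformBits m >>= λ α → return (h , α)

    𝔼-cell : ∀ (f : Cell → ℚ) → 𝔼 randomCell f ≡ 𝔼 c (λ h → 𝔼 (uniformBits m) (λ α → f (h , α)))
    𝔼-cell = 𝔼->>= c (λ h → uniformBits m >>= λ α → return (h , α))

    ∈cell : Bits n → Cell → ℚ
    ∈cell y (h , α) = ⟨ does (h y ≟ᴮ α) ⟩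

    count : Cell → ℕ
    count (h , α) = # (restrict G h α)

    private
      w : ℚ
      w = ½^ m
      g : Fin (2 ^ n) → ℚ
      g t = ⟨ G (Vec.lookup (allBits n) t) ⟩
      point : Fin (2 ^ n) → Bits n
      point = Vec.lookup (allBits n)

    #-as-sum : ι (# G) ≡ sum g
    #-as-sum = countᵇ-as-sum G (allBits n)

    count-as-sum : ∀ s → ι (count s) ≡ sum (λ t → g t * ∈cell (point t) s)
    count-as-sum (h , α) = trans (countᵇ-as-sum (restrict G h α) (allBits n))
      (sum-cong-≗ (λ t → ⟨∧⟩ (G (point t)) (does (h (point t) ≟ᴮ α))))

    -- For each fixed h, exactly one of the 2ᵐ equally likely values α equals h y.
    𝔼-∈cell : ∀ y → 𝔼 randomCell (∈cell y) ≡ w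
    𝔼-∈cell y = begin
      𝔼 randomCell (∈cell y)
        ≡⟨ 𝔼-cell (∈cell y) ⟩
      𝔼 c (λ h → w * Σᴮ m (λ α → ⟨ does (h y ≟ᴮ α) ⟩))
        ≡⟨ 𝔼-cong c (λ h → cong (w *_) (Σᴮ-≟ (h y))) ⟩
      𝔼 c (λ h → w * 1ℚ)
        ≡⟨ 𝔼-const c (w * 1ℚ) ⟩
      w * 1ℚ
        ≡⟨ ℚ.*-identityʳ w ⟩
      w ∎
      where open ≡-Reasoning

    -- With the averages exchanged, α is fixed while h varies, and pairwise independence applies
    -- with α as the target of both points.
    𝔼-∈cell-pair : ∀ {y y′} → y ≢ y′ → 𝔼 randomCell (λ s → ∈cell y s * ∈cell y′ s) ≡ w * w
    𝔼-∈cell-pair {y} {y′} y≢y′ = begin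
      𝔼 randomCell (λ s → ∈cell y s * ∈cell y′ s)
        ≡⟨ 𝔼-cell (λ s → ∈cell y s * ∈cell y′ s) ⟩
      𝔼 c (λ h → 𝔼 (uniformBits m) (λ α → ∈cell y (h , α) * ∈cell y′ (h , α)))
        ≡⟨ 𝔼-comm c (uniformBits m) (λ h α → ∈cell y (h , α) * ∈cell y′ (h , α)) ⟩
      𝔼 (uniformBits m) (λ α → 𝔼 c (λ h → ∈cell y (h , α) * ∈cell y′ (h , α)))
        ≡⟨ 𝔼-cong (uniformBits m) (λ α → pairwise c independent y≢y′ α α) ⟩
      𝔼 (uniformBits m) (λ α → w * w)
        ≡⟨ 𝔼-const (uniformBits m) (w * w) ⟩
      w * w ∎
      where open ≡-Reasoning

    0≤w : 0ℚ ≤ w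
    0≤w = ℚ.nonNegative⁻¹ w {{1/n-nonNeg (2 ^ m) {{ℕ.m^n≢0 2 m}}}}

    -- One formula for equal and distinct points, so that the double sum needs no case split. On the
    -- diagonal the expectation is w, and w * w is slack.
    𝔼-∈cell-pair-≤ : ∀ y y′ →
      𝔼 randomCell (λ s → ∈cell y s * ∈cell y′ s) ≤ ⟨ does (y ≟ᴮ y′) ⟩ * w + w * w
    𝔼-∈cell-pair-≤ y y′ with y ≟ᴮ y′
    ... | no  y≢y′ = ℚ.≤-reflexive (trans (𝔼-∈cell-pair y≢y′)
      (solve 1 (λ x → x :* x := con 0ℚ :* x :+ x :* x) refl w))
    ... | yes refl = begin
      𝔼 randomCell (λ s → ∈cell y s * ∈cell y s)
        ≡⟨ 𝔼-cong randomCell (λ (h , α) → ⟨⟩-idem (does (h y ≟ᴮ α))) ⟩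
      𝔼 randomCell (∈cell y)
        ≡⟨ 𝔼-∈cell y ⟩
      w
        ≡⟨ solve 1 (λ x → x := con 1ℚ :* x :+ x :* con 0ℚ) refl w ⟩
      1ℚ * w + w * 0ℚ
        ≤⟨ ℚ.+-monoʳ-≤ (1ℚ * w) (*-mono-nonNeg 0≤w 0≤w) ⟩
      1ℚ * w + w * w ∎
      where open ℚ.≤-Reasoning

    𝔼-count : 𝔼 randomCell (ι ∘ count) ≡ ι (# G) * w
    𝔼-count = begin
      𝔼 randomCell (ι ∘ count)
        ≡⟨ 𝔼-cong randomCell count-as-sum ⟩
      𝔼 randomCell (λ s → sum (λ t → g t * ∈cell (point t) s))
        ≡⟨ 𝔼-sum randomCell (λ t s → g t * ∈cell (point t) s) ⟩
      sum (λ t → 𝔼 randomCell (λ s → g t * ∈cell (point t) s))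
        ≡⟨ sum-cong-≗ (λ t → trans (𝔼-* randomCell (g t) (∈cell (point t))) (cong (g t *_) (𝔼-∈cell (point t)))) ⟩
      sum (λ t → g t * w)
        ≡⟨ *-distribʳ-sum w g ⟨
      sum g * w
        ≡⟨ cong (_* w) #-as-sum ⟨
      ι (# G) * w ∎
      where open ≡-Reasoning

    -- The square is expanded into a double sum over pairs of points. The diagonal contributes the
    -- mean and the product terms the squared mean, so the variance is at most the mean.
    𝔼-count² : 𝔼 randomCell (λ s → ι (count s) * ι (count s))
             ≤ ι (# G) * w + (ι (# G) * w) * (ι (# G) * w)
    𝔼-count² = begin
      𝔼 randomCell (λ s → ι (count s) * ι (count s))
        ≡⟨ 𝔼-cong randomCell (λ s → trans (cong₂ _*_ (count-as-sum s) (count-as-sum s))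
             (trans (sum-*-sum (λ t → g t * ∈cell (point t) s) (λ t → g t * ∈cell (point t) s))
               (sum-cong-≗ (λ t → sum-cong-≗ (λ u →
                 solve 4 (λ a b c d → (a :* b) :* (c :* d) := (a :* c) :* (b :* d)) refl
                   (g t) (∈cell (point t) s) (g u) (∈cell (point u) s)))))) ⟩
      𝔼 randomCell (λ s → sum (λ t → sum (λ u → (g t * g u) * (∈cell (point t) s * ∈cell (point u) s))))
        ≡⟨ trans (𝔼-sum randomCell (λ t s → sum (λ u → (g t * g u) * (∈cell (point t) s * ∈cell (point u) s))))
             (sum-cong-≗ (λ t → trans (𝔼-sum randomCell (λ u s → (g t * g u) * (∈cell (point t) s * ∈cell (point u) s)))
               (sum-cong-≗ (λ u → 𝔼-* randomCell (g t * g u) (λ s → ∈cell (point t) s * ∈cell (point u) s))))) ⟩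
      sum (λ t → sum (λ u → (g t * g u) * 𝔼 randomCell (λ s → ∈cell (point t) s * ∈cell (point u) s)))
        ≤⟨ sum-mono (λ t → sum-mono (λ u → *-mono-nonNeg (0≤gg t u) (𝔼-∈cell-pair-≤ (point t) (point u)))) ⟩
      sum (λ t → sum (λ u → (g t * g u) * (⟨ does (point t ≟ᴮ point u) ⟩ * w + w * w)))
        ≡⟨ sum-cong-≗ row ⟩
      sum (λ t → g t * w + g t * (sum g * (w * w)))
        ≡⟨ ∑-distrib-+ (λ t → g t * w) (λ t → g t * (sum g * (w * w))) ⟩
      sum (λ t → g t * w) + sum (λ t → g t * (sum g * (w * w)))
        ≡⟨ cong₂ _+_ (*-distribʳ-sum w g) (*-distribʳ-sum (sum g * (w * w)) g) ⟨
      sum g * w + sum g * (sum g * (w * w))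
        ≡⟨ solve 2 (λ x y → x :* y :+ x :* (x :* (y :* y)) := x :* y :+ (x :* y) :* (x :* y)) refl (sum g) w ⟩
      sum g * w + (sum g * w) * (sum g * w)
        ≡⟨ cong (λ x → x * w + (x * w) * (x * w)) #-as-sum ⟨
      ι (# G) * w + (ι (# G) * w) * (ι (# G) * w) ∎
      where
      open ℚ.≤-Reasoning
      0≤gg : ∀ t u → 0ℚ ≤ g t * g u
      0≤gg t u = ℚ.≤-trans (⟨⟩-nonNeg (G (point t) ∧ G (point u))) (ℚ.≤-reflexive (⟨∧⟩ (G (point t)) (G (point u))))
      row : ∀ t → sum (λ u → (g t * g u) * (⟨ does (point t ≟ᴮ point u) ⟩ * w + w * w))
                ≡ g t * w + g t * (sum g * (w * w))
      row t = begin-equality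
        sum (λ u → (g t * g u) * (⟨ does (point t ≟ᴮ point u) ⟩ * w + w * w))
          ≡⟨ sum-cong-≗ (λ u → solve 4
               (λ a b d x → (a :* b) :* (d :* x :+ x :* x) := d :* (a :* b :* x) :+ a :* (b :* (x :* x)))
               refl (g t) (g u) ⟨ does (point t ≟ᴮ point u) ⟩ w) ⟩
        sum (λ u → ⟨ does (point t ≟ᴮ point u) ⟩ * (g t * g u * w) + g t * (g u * (w * w)))
          ≡⟨ ∑-distrib-+ (λ u → ⟨ does (point t ≟ᴮ point u) ⟩ * (g t * g u * w)) (λ u → g t * (g u * (w * w))) ⟩
        sum (λ u → ⟨ does (point t ≟ᴮ point u) ⟩ * (g t * g u * w)) + sum (λ u → g t * (g u * (w * w)))
          -- The Dirac sum leaves only u = t, where the product of the two indicators of G is a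
          -- single indicator.
          ≡⟨ cong₂ _+_ (trans (Σᴮ-dirac (point t) (λ y → g t * ⟨ G y ⟩ * w)) (cong (_* w) (⟨⟩-idem (G (point t)))))
               (trans (sym (*-distribˡ-sum (g t) (λ u → g u * (w * w))))
                 (cong (g t *_) (sym (*-distribʳ-sum (w * w) g)))) ⟩
        g t * w + g t * (sum g * (w * w)) ∎

    -- A random cell has M elements on average, with variance at most M.  A quadratic minorant of the
    -- pay-off as a function of the number of elements therefore bounds the expected pay-off.
    moment-bound : ∀ {M} → # G ≡ 2 ^ m ℕ.* M → ∀ a b K e (f : Cell → ℚ) →
      (∀ s → ι (a ℕ.+ b ℕ.* count s) ≤ ι K * f s + ι (count s ℕ.* count s ℕ.+ e)) →
      ι (a ℕ.+ b ℕ.* M) ≤ ι K * 𝔼 randomCell f + ι (M ℕ.+ M ℕ.* M ℕ.+ e)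
    -- The minorant is (a + b z - z² - e) / K at z = `count s`; z² and e stand on the right so that
    -- all coefficients are naturals.
    moment-bound {M} #G≡ a b K e f f-bound = begin
      ι (a ℕ.+ b ℕ.* M)
        ≡⟨ lin M ⟩
      ι a + ι b * ι M
        ≡⟨ cong₂ _+_ (𝔼-const randomCell (ι a))
             (trans (𝔼-* randomCell (ι b) (ι ∘ count)) (cong (ι b *_) (trans 𝔼-count Xw))) ⟨
      𝔼 randomCell (λ _ → ι a) + 𝔼 randomCell (λ s → ι b * ι (count s))
        ≡⟨ 𝔼-+ randomCell (λ _ → ι a) (λ s → ι b * ι (count s)) ⟨
      𝔼 randomCell (λ s → ι a + ι b * ι (count s))
        ≡⟨ 𝔼-cong randomCell (lin ∘ count) ⟨
      𝔼 randomCell (λ s → ι (a ℕ.+ b ℕ.* count s))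
        ≤⟨ 𝔼-mono randomCell f-bound ⟩
      𝔼 randomCell (λ s → ι K * f s + ι (count s ℕ.* count s ℕ.+ e))
        ≡⟨ trans (𝔼-+ randomCell (λ s → ι K * f s) (λ s → ι (count s ℕ.* count s ℕ.+ e)))
             (cong₂ _+_ (𝔼-* randomCell (ι K) f) square) ⟩
      ι K * 𝔼 randomCell f + (𝔼 randomCell (λ s → ι (count s) * ι (count s)) + ι e)
        ≤⟨ ℚ.+-monoʳ-≤ (ι K * 𝔼 randomCell f) (ℚ.+-monoˡ-≤ (ι e) 𝔼-count²) ⟩
      ι K * 𝔼 randomCell f + ((ι (# G) * w + (ι (# G) * w) * (ι (# G) * w)) + ι e)
        ≡⟨ cong (λ x → ι K * 𝔼 randomCell f + ((x + x * x) + ι e)) Xw ⟩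
      ι K * 𝔼 randomCell f + ((ι M + ι M * ι M) + ι e)
        ≡⟨ cong (_+_ (ι K * 𝔼 randomCell f)) (trans (ι-+ (M ℕ.+ M ℕ.* M) e)
             (cong (_+ ι e) (trans (ι-+ M (M ℕ.* M)) (cong (_+_ (ι M)) (ι-* M M))))) ⟨
      ι K * 𝔼 randomCell f + ι (M ℕ.+ M ℕ.* M ℕ.+ e) ∎
      where
      open ℚ.≤-Reasoning
      lin : ∀ z → ι (a ℕ.+ b ℕ.* z) ≡ ι a + ι b * ι z
      lin z = trans (ι-+ a (b ℕ.* z)) (cong (_+_ (ι a)) (ι-* b z))
      Xw : ι (# G) * w ≡ ι M
      Xw = begin-equality
        ι (# G) * w              ≡⟨ cong (λ x → ι x * w) #G≡ ⟩
        ι (2 ^ m ℕ.* M) * w      ≡⟨ cong (_* w) (ι-* (2 ^ m) M) ⟩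
        ι (2 ^ m) * ι M * w      ≡⟨ solve 3 (λ x y z → x :* y :* z := y :* (x :* z)) refl (ι (2 ^ m)) (ι M) w ⟩
        ι M * (ι (2 ^ m) * w)    ≡⟨ cong (ι M *_) (½^-inverse m) ⟩
        ι M * 1ℚ                 ≡⟨ ℚ.*-identityʳ (ι M) ⟩
        ι M                      ∎
      square : 𝔼 randomCell (λ s → ι (count s ℕ.* count s ℕ.+ e))
             ≡ 𝔼 randomCell (λ s → ι (count s) * ι (count s)) + ι e
      square = begin-equality
        𝔼 randomCell (λ s → ι (count s ℕ.* count s ℕ.+ e))
          ≡⟨ 𝔼-cong randomCell (λ s → trans (ι-+ (count s ℕ.* count s) e) (cong (_+ ι e) (ι-* (count s) (count s)))) ⟩
        𝔼 randomCell (λ s → ι (count s) * ι (count s) + ι e)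
          ≡⟨ trans (𝔼-+ randomCell (λ s → ι (count s) * ι (count s)) (λ _ → ι e))
               (cong (_+_ (𝔼 randomCell (λ s → ι (count s) * ι (count s)))) (𝔼-const randomCell (ι e))) ⟩
        𝔼 randomCell (λ s → ι (count s) * ι (count s)) + ι e ∎

  -- Rational inequalities with denominators cleared.

  ι-nonNegative : ∀ n → 0ℚ ≤ ι n
  ι-nonNegative n = ℚ.nonNegative⁻¹ (ι n) {{ι-nonNeg n}}

  ι-scale : ∀ s {N K x} → ι N ≤ ι K * x → ι (s ℕ.* N) ≤ ι (s ℕ.* K) * x
  ι-scale s {N} {K} {x} N≤Kx = begin
    ι (s ℕ.* N)       ≡⟨ ι-* s N ⟩
    ι s * ι N         ≤⟨ *-mono-nonNeg (ι-nonNegative s) N≤Kx ⟩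
    ι s * (ι K * x)   ≡⟨ ℚ.*-assoc (ι s) (ι K) x ⟨
    ι s * ι K * x     ≡⟨ cong (_* x) (ι-* s K) ⟨
    ι (s ℕ.* K) * x   ∎
    where open ℚ.≤-Reasoning

  ι-cancel : ∀ s .{{_ : NonZero s}} {N K x r} →
             ι (s ℕ.* N ℕ.+ r) ≤ ι (s ℕ.* K) * x + ι r → ι N ≤ ι K * x
  ι-cancel s {N} {K} {x} {r} le = ℚ.*-cancelˡ-≤-pos (ι s) {{ι-pos s}} (begin
    ι s * ι N
      ≡⟨ solve 2 (λ y z → y := (y :+ z) :+ con (ℚ.- 1ℚ) :* z) refl (ι s * ι N) (ι r) ⟩
    (ι s * ι N + ι r) + (ℚ.- 1ℚ) * ι r
      ≡⟨ cong (_+ (ℚ.- 1ℚ) * ι r) (trans (ι-+ (s ℕ.* N) r) (cong (_+ ι r) (ι-* s N))) ⟨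
    ι (s ℕ.* N ℕ.+ r) + (ℚ.- 1ℚ) * ι r
      ≤⟨ ℚ.+-monoˡ-≤ ((ℚ.- 1ℚ) * ι r) le ⟩
    (ι (s ℕ.* K) * x + ι r) + (ℚ.- 1ℚ) * ι r
      ≡⟨ solve 2 (λ y z → (y :+ z) :+ con (ℚ.- 1ℚ) :* z := y) refl (ι (s ℕ.* K) * x) (ι r) ⟩
    ι (s ℕ.* K) * x
      ≡⟨ cong (_* x) (ι-* s K) ⟩
    ι s * ι K * x
      ≡⟨ ℚ.*-assoc (ι s) (ι K) x ⟩
    ι s * (ι K * x) ∎)
    where open ℚ.≤-Reasoning

  -- Brings a lower bound N₁ / K on the pay-off, together with an inequality between naturals, into
  -- the shape that `moment-bound` expects.
  ι-weaken : ∀ {N N₁ K x r} → ι N₁ ≤ ι K * x → N ℕ.≤ N₁ ℕ.+ r → ι N ≤ ι K * x + ι r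
  ι-weaken {N} {N₁} {K} {x} {r} N₁≤Kx N≤ = begin
    ι N             ≤⟨ ι-mono-≤ N≤ ⟩
    ι (N₁ ℕ.+ r)    ≡⟨ ι-+ N₁ r ⟩
    ι N₁ + ι r      ≤⟨ ℚ.+-monoˡ-≤ (ι r) N₁≤Kx ⟩
    ι K * x + ι r   ∎
    where open ℚ.≤-Reasoning

  -- Success probabilities and witness counts.

  Pr->>= : ∀ {A B : Set} E (c : Rand A) (k : A → Rand B) → Pr E (c >>= k) ≡ 𝔼 c (λ a → Pr E (k a))
  Pr->>= E (return a) k = refl
  Pr->>= E (draw N h) k = cong ((+ 1 / N) *_) (sum-cong-≗ (λ i → Pr->>= E (h i) k))

  Pr-nonNeg : ∀ {A : Set} E (c : Rand A) → 0ℚ ≤ Pr E c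
  Pr-nonNeg E c = begin
    0ℚ               ≡⟨ 𝔼-const c 0ℚ ⟨
    𝔼 c (λ _ → 0ℚ)   ≤⟨ 𝔼-mono c (λ a → ⟨⟩-nonNeg (E a)) ⟩
    𝔼 c (⟨_⟩ ∘ E)    ≡⟨ Pr-as-𝔼 E c ⟨
    Pr E c           ∎
    where open ℚ.≤-Reasoning

  sum-<? : ∀ {a p} → a ℕ.≤ p → sum {p} (λ j → ⟨ does (toℕ j <? a) ⟩) ≡ ι a
  sum-<? {p = p} z≤n       = trans (sum-const p 0ℚ) (trans (ℚ.*-zeroʳ (ι p)) (sym ι-0))
  sum-<? {a = suc a} (s≤s a≤p) = trans (cong₂ _+_ (sym ι-1) (sum-<? a≤p)) (sym (ι-+ 1 a))

  -- The Dirac sum at the witness z equals 1, and each of its terms is at most the corresponding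
  -- term of the count.
  Satisfiable⇒1≤# : ∀ {n} (G : Constraint n) → Satisfiable G → 1 ℕ.≤ # G
  Satisfiable⇒1≤# {n} G (z , Gz) = ι-cancel-≤ (begin
    ι 1
      ≡⟨ trans ι-1 (sym (true⇒1 (G z) Gz)) ⟩
    ⟨ G z ⟩
      ≡⟨ Σᴮ-dirac z (λ x → ⟨ G x ⟩) ⟨
    Σᴮ n (λ x → ⟨ does (z ≟ᴮ x) ⟩ * ⟨ G x ⟩)
      ≤⟨ sum-mono (λ t → drop (does (z ≟ᴮ Vec.lookup (allBits n) t)) (G (Vec.lookup (allBits n) t))) ⟩
    Σᴮ n (λ x → ⟨ G x ⟩)
      ≡⟨ countᵇ-as-sum G (allBits n) ⟨
    ι (# G) ∎)
    where
    open ℚ.≤-Reasoning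
    true⇒1 : ∀ b → T b → ⟨ b ⟩ ≡ 1ℚ
    true⇒1 true _ = refl
    drop : ∀ a b → ⟨ a ⟩ * ⟨ b ⟩ ≤ ⟨ b ⟩
    drop true  b = ℚ.≤-reflexive (ℚ.*-identityˡ ⟨ b ⟩)
    drop false b = ℚ.≤-trans (ℚ.≤-reflexive (ℚ.*-zeroˡ ⟨ b ⟩)) (⟨⟩-nonNeg b)

  -- A single iteration of the loop.

  module Analysis {n r : ℕ} (H : ∀ m → .(m ℕ.≤ n) → HashFamily n m r) (B : BoundedSAT n)
                  (F : CNF n) (k : ℕ) (2≤r : 2 ℕ.≤ r) (r≤2ⁿ : r ℕ.≤ 2 ^ n) where

    open BoundedSAT B using (card) renaming (solve to sat)

    p l : ℕ
    p = pivot n k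
    l = start n k

    is-just-element : ∀ S j → is-just (element H B F k S j) ≡ does (j <? length S)
    is-just-element S j with j <? length S
    ... | yes j<|S| = sym (dec-true (j <? length S) j<|S|)
    ... | no  j≮|S| = sym (dec-false (j <? length S) j≮|S|)

    -- Of the p equally likely indices, exactly `length S` yield an element.
    Pr-finish : ∀ S → 1 ℕ.≤ length S → length S ℕ.≤ p →
                ι p * Pr is-just (finish H B F k S) ≡ ι (length S)
    Pr-finish S 1≤|S| |S|≤p with 1 ≤? length S | length S ≤? p
    ... | no ¬1≤|S| | _         = contradiction 1≤|S| ¬1≤|S|
    ... | yes _     | no ¬|S|≤p = contradiction |S|≤p ¬|S|≤p
    ... | yes 1≤    | yes ≤p    = begin
      ι p * ((+ 1 / p) * sum {p} (λ j → ⟨ is-just (element H B F k S (toℕ j)) ⟩))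
        ≡⟨ ℚ.*-assoc (ι p) (+ 1 / p) _ ⟨
      ι p * (+ 1 / p) * sum {p} (λ j → ⟨ is-just (element H B F k S (toℕ j)) ⟩)
        ≡⟨ cong₂ _*_ (ι-*-inverse p) (sum-cong-≗ {p} (λ j → cong ⟨_⟩ (is-just-element S (toℕ j)))) ⟩
      1ℚ * sum {p} (λ j → ⟨ does (toℕ j <? length S) ⟩)
        ≡⟨ trans (ℚ.*-identityˡ _) (sum-<? |S|≤p) ⟩
      ι (length S) ∎
      where
      open ≡-Reasoning
      instance
        p≢0 : NonZero p
        p≢0 = ℕ.>-nonZero (ℕ.≤-trans 1≤ ≤p)

    InRange : ℕ → Set
    InRange z = 1 ℕ.≤ z × z ℕ.≤ p

    until-inside : ∀ d i .(eq : i ℕ.+ d ≡ n) S → InRange (length S) →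
                   until H B F k d i eq S ≡ finish H B F k S
    until-inside zero    i eq S _ = refl
    until-inside (suc d) i eq S in-range
      rewrite dec-true (1 ≤? length S ×-dec length S ≤? p) in-range = refl

    -- Stated for `suc d`, because the last iteration passes every set to `finish`.
    until-outside : ∀ d i .(eq : i ℕ.+ suc d ≡ n) S → ¬ InRange (length S) →
                    until H B F k (suc d) i eq S
                      ≡ loop H B F k d (suc i) (trans (sym (ℕ.+-suc i d)) eq)
    until-outside d i eq S out
      rewrite dec-false (1 ≤? length S ×-dec length S ≤? p) out = refl

    -- With the cap p + 1, the size of the returned set is the true count if that is at most p, and
    -- exceeds p otherwise. `outside` records the count for the base case and the failed exit test
    -- for the induction step.
    data Outcome (G : Constraint n) : Set where
      inside  : InRange (# G) → length (sat G (p ℕ.+ 1)) ≡ # G → Outcome G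
      outside : # G ≡ 0 ⊎ p < # G → ¬ InRange (length (sat G (p ℕ.+ 1))) → Outcome G

    outcome : ∀ G → Outcome G
    outcome G with 1 ≤? # G | # G ≤? p
    ... | yes 1≤# | yes #≤p = inside (1≤# , #≤p)
      (trans (card G (p ℕ.+ 1)) (ℕ.m≥n⇒m⊓n≡n (ℕ.≤-trans #≤p (ℕ.m≤m+n p 1))))
    ... | no ¬1≤# | _       = outside (inj₁ #≡0) (λ (1≤|S| , _) → ¬1≤#
      (ℕ.≤-trans 1≤|S| (ℕ.≤-trans (ℕ.≤-reflexive (card G (p ℕ.+ 1))) (ℕ.m⊓n≤n (p ℕ.+ 1) (# G)))))
      where
      #≡0 : # G ≡ 0
      #≡0 = ℕ.n<1⇒n≡0 (ℕ.≰⇒> ¬1≤#)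
    ... | yes _   | no #≰p  = outside (inj₂ (ℕ.≰⇒> #≰p)) (λ (_ , |S|≤p) → ℕ.<⇒≱ p<|S| |S|≤p)
      where
      p<|S| : p < length (sat G (p ℕ.+ 1))
      p<|S| = ℕ.≤-reflexive (trans (ℕ.+-comm 1 p) (sym (trans (card G (p ℕ.+ 1))
        (ℕ.m≤n⇒m⊓n≡m (ℕ.≤-trans (ℕ.≤-reflexive (ℕ.+-comm p 1)) (ℕ.≰⇒> #≰p))))))

    hash : ∀ i d → .(i ℕ.+ d ≡ n) → Rand (Bits n → Bits (i ∸ l))
    hash i d eq = HashFamily.random (H (i ∸ l)
      (ℕ.≤-trans (ℕ.m∸n≤m i l) (ℕ.≤-trans (ℕ.m≤m+n i d) (ℕ.≤-reflexive eq))))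

    -- The degree r is written as 2 + (r ∸ 2) and lowered to 2, the degree that the second moment
    -- calls for.
    hash-independent : ∀ i d .(eq : i ℕ.+ d ≡ n) → Independent (hash i d eq) 2
    hash-independent i d eq = independent-≤ (hash i d eq) (r ∸ 2)
      (subst (ℕ._≤ 2 ^ n) (sym (ℕ.m+[n∸m]≡n 2≤r)) r≤2ⁿ)
      (subst (Independent (hash i d eq)) (sym (ℕ.m+[n∸m]≡n 2≤r))
        (family-independent (H (i ∸ l) (ℕ.≤-trans (ℕ.m∸n≤m i l) (ℕ.≤-trans (ℕ.m≤m+n i d) (ℕ.≤-reflexive eq))))))

    module Round (i d : ℕ) .(eq : i ℕ.+ d ≡ n) where

      open Cells (hash i d eq) (hash-independent i d eq) ⟦ F ⟧ public

      attempt : (Bits n → Bits (i ∸ l)) → Bits (i ∸ l) → Rand (Maybe (Bits n))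
      attempt h α = until H B F k d i eq (sat (restrict ⟦ F ⟧ h α) (p ℕ.+ 1))

      -- The pay-off of a cell: the probability of eventual success once it is drawn, later
      -- iterations included.
      success : Cell → ℚ
      success (h , α) = Pr is-just (attempt h α)

      Pr-loop : Pr is-just (loop H B F k d i eq) ≡ 𝔼 randomCell success
      Pr-loop = begin
        Pr is-just (loop H B F k d i eq)
          ≡⟨ Pr->>= is-just (hash i d eq) (λ h → uniformBits (i ∸ l) >>= attempt h) ⟩
        𝔼 (hash i d eq) (λ h → Pr is-just (uniformBits (i ∸ l) >>= attempt h))
          ≡⟨ 𝔼-cong (hash i d eq) (λ h → Pr->>= is-just (uniformBits (i ∸ l)) (attempt h)) ⟩
        𝔼 (hash i d eq) (λ h → 𝔼 (uniformBits (i ∸ l)) (λ α → success (h , α)))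
          ≡⟨ 𝔼-cell success ⟨
        𝔼 randomCell success ∎
        where open ≡-Reasoning

      success-inside : ∀ s → InRange (count s) →
                       length (sat (restrict ⟦ F ⟧ (proj₁ s) (proj₂ s)) (p ℕ.+ 1)) ≡ count s →
                       ι p * success s ≡ ι (count s)
      success-inside (h , α) (1≤z , z≤p) |S|≡z = begin
        ι p * success (h , α)
          ≡⟨ cong (λ c → ι p * Pr is-just c) (until-inside d i eq S (1≤|S| , |S|≤p)) ⟩
        ι p * Pr is-just (finish H B F k S)
          ≡⟨ Pr-finish S 1≤|S| |S|≤p ⟩
        ι (length S)
          ≡⟨ cong ι |S|≡z ⟩
        ι (count (h , α)) ∎
        where
        open ≡-Reasoning
        S = sat (restrict ⟦ F ⟧ h α) (p ℕ.+ 1)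
        1≤|S| : 1 ℕ.≤ length S
        1≤|S| = subst (1 ℕ.≤_) (sym |S|≡z) 1≤z
        |S|≤p : length S ℕ.≤ p
        |S|≤p = subst (ℕ._≤ p) (sym |S|≡z) z≤p

    -- Induction from iteration l + c back to the first.

    module _ (sc : Scale n k (# ⟦ F ⟧)) where
      open Scale sc

      private
        instance
          μ≢0 : NonZero μ
          μ≢0 = ℕ.>-nonZero 1≤μ

      -- 1/8 + 1/8D ≤ v for D = 2ʲ, with denominators cleared.
      loop-bound : ∀ j d i (eq : i ℕ.+ d ≡ n) → l ℕ.≤ i → i ℕ.+ j ≡ l ℕ.+ c →
                   ι (2 ^ j ℕ.+ 1) ≤ ι (8 ℕ.* 2 ^ j) * Pr is-just (loop H B F k d i eq)
      -- Here D = 1 and the mean is μ. After cancelling μ + μ², the moment bound reads μ² ≤ 4μ² v,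
      -- so v ≥ 1/4; doubling 1 ≤ 4 v gives 2 ≤ 8 v.
      loop-bound zero d i eq l≤i i+j≡l+c =
        ι-scale 2 {1} {4} (ι-cancel (μ ℕ.* μ) {{ℕ.m*n≢0 μ μ}} (subst₂ _≤_
          (cong ι (eq₁ μ))
          (cong₂ _+_ (cong₂ _*_ (cong ι (trans (cong (2 ℕ.* μ ℕ.*_) pivot≡2μ) (eq₂ μ))) (sym Pr-loop))
            (cong ι (ℕ.+-identityʳ _)))
          (moment-bound #≡ 0 (2 ℕ.* μ ℕ.+ 1) (2 ℕ.* μ ℕ.* p) 0 success bound)))
        where
        open Round i d eq
        #≡ : # ⟦ F ⟧ ≡ 2 ^ (i ∸ l) ℕ.* μ
        #≡ = trans X≡ (cong (λ e → 2 ^ e ℕ.* μ)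
          (sym (trans (cong (_∸ l) (trans (sym (ℕ.+-identityʳ i)) i+j≡l+c)) (ℕ.m+n∸m≡n l c))))
        eq₁ : ∀ μ → 0 ℕ.+ (2 ℕ.* μ ℕ.+ 1) ℕ.* μ ≡ μ ℕ.* μ ℕ.* 1 ℕ.+ (μ ℕ.+ μ ℕ.* μ)
        eq₁ = solve-∀
        eq₂ : ∀ μ → 2 ℕ.* μ ℕ.* (2 ℕ.* μ) ≡ μ ℕ.* μ ℕ.* 4
        eq₂ = solve-∀
        bound : ∀ s → ι (0 ℕ.+ (2 ℕ.* μ ℕ.+ 1) ℕ.* count s)
                    ≤ ι (2 ℕ.* μ ℕ.* p) * success s + ι (count s ℕ.* count s ℕ.+ 0)
        bound s@(h , α) with outcome (restrict ⟦ F ⟧ h α)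
        ... | inside in-range |S|≡z = ι-weaken {N₁ = 2 ℕ.* μ ℕ.* count s}
          (ι-scale (2 ℕ.* μ) (ℚ.≤-reflexive (sym (success-inside s in-range |S|≡z))))
          (ℕ.≤-trans (base-minorant μ (count s) (proj₁ in-range))
            (ℕ.≤-reflexive (cong (2 ℕ.* μ ℕ.* count s ℕ.+_) (sym (ℕ.+-identityʳ _)))))
        -- Out of range, z = 0 or z ≥ 2μ + 1, so z (2μ + 1 - z) ≤ 0 and non-negativity of the
        -- pay-off suffices.
        ... | outside out _ = ι-weaken {N₁ = 0}
          (ℚ.≤-trans (ℚ.≤-reflexive (trans ι-0 (sym (ℚ.*-zeroʳ (ι (2 ℕ.* μ ℕ.* p))))))
            (*-mono-nonNeg (ι-nonNegative (2 ℕ.* μ ℕ.* p)) (Pr-nonNeg is-just (attempt h α))))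
          (outside-≤ out)
          where
          outside-≤ : ∀ {z} → z ≡ 0 ⊎ p < z → (2 ℕ.* μ ℕ.+ 1) ℕ.* z ℕ.≤ z ℕ.* z ℕ.+ 0
          outside-≤ (inj₁ refl) = ℕ.≤-reflexive (ℕ.*-zeroʳ (2 ℕ.* μ ℕ.+ 1))
          outside-≤ {z} (inj₂ p<z) = ℕ.≤-trans
            (ℕ.*-monoˡ-≤ z (ℕ.≤-trans (ℕ.≤-reflexive (trans (cong (ℕ._+ 1) (sym pivot≡2μ)) (ℕ.+-comm p 1))) p<z))
            (ℕ.≤-reflexive (sym (ℕ.+-identityʳ _)))
      -- No iteration remains, so i = n, while i < l + c ≤ n.
      loop-bound (suc j) zero i eq l≤i i+j≡l+c = contradiction l+c≤n (ℕ.<⇒≱ (begin-strict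
        n                ≡⟨ eq ⟨
        i ℕ.+ 0          <⟨ ℕ.+-monoʳ-< i (s≤s z≤n) ⟩
        i ℕ.+ suc j      ≡⟨ i+j≡l+c ⟩
        l ℕ.+ c          ∎))
        where open ℕ.≤-Reasoning
      -- The minorant is multiplied by 8D²μ, with M = Dμ. The variance, at most Dμ, costs 1/8D of
      -- the available 1/8 + 1/4D; the common factor Dμ is cancelled at the end.
      loop-bound (suc j) (suc d) i eq l≤i i+j≡l+c =
        ι-cancel (D ℕ.* μ) {{ℕ.m*n≢0 D μ {{ℕ.m^n≢0 2 (suc j)}}}} (subst₂ _≤_
          (cong ι (eq₁ D μ))
          (cong (_+ ι (D ℕ.* μ ℕ.+ D ℕ.* μ ℕ.* (D ℕ.* μ) ℕ.+ D ℕ.* μ ℕ.* (D ℕ.* μ)))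
            (cong₂ _*_ (cong ι (trans (cong (4 ℕ.* (D ℕ.* D) ℕ.*_) pivot≡2μ) (eq₂ D μ))) (sym Pr-loop)))
          (moment-bound #≡ ((D ℕ.* D ℕ.+ 2 ℕ.* D) ℕ.* μ) (2 ℕ.* (D ℕ.* μ))
            (4 ℕ.* (D ℕ.* D) ℕ.* p) (D ℕ.* μ ℕ.* (D ℕ.* μ)) success bound))
        where
        open Round i (suc d) eq
        D D′ : ℕ
        D  = 2 ^ suc j
        D′ = 2 ^ j
        #≡ : # ⟦ F ⟧ ≡ 2 ^ (i ∸ l) ℕ.* (D ℕ.* μ)
        #≡ = begin
          # ⟦ F ⟧                           ≡⟨ X≡ ⟩
          2 ^ c ℕ.* μ                       ≡⟨ cong (λ e → 2 ^ e ℕ.* μ) (ℕ.m+n∸m≡n l c) ⟨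
          2 ^ (l ℕ.+ c ∸ l) ℕ.* μ           ≡⟨ cong (λ e → 2 ^ (e ∸ l) ℕ.* μ) i+j≡l+c ⟨
          2 ^ (i ℕ.+ suc j ∸ l) ℕ.* μ       ≡⟨ cong (λ e → 2 ^ e ℕ.* μ) (ℕ.+-∸-comm (suc j) l≤i) ⟩
          2 ^ (i ∸ l ℕ.+ suc j) ℕ.* μ       ≡⟨ cong (ℕ._* μ) (ℕ.^-distribˡ-+-* 2 (i ∸ l) (suc j)) ⟩
          2 ^ (i ∸ l) ℕ.* D ℕ.* μ           ≡⟨ ℕ.*-assoc (2 ^ (i ∸ l)) D μ ⟩
          2 ^ (i ∸ l) ℕ.* (D ℕ.* μ)         ∎
          where open ≡-Reasoning
        eq₁ : ∀ D μ → (D ℕ.* D ℕ.+ 2 ℕ.* D) ℕ.* μ ℕ.+ 2 ℕ.* (D ℕ.* μ) ℕ.* (D ℕ.* μ)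
                    ≡ D ℕ.* μ ℕ.* (D ℕ.+ 1) ℕ.+ (D ℕ.* μ ℕ.+ D ℕ.* μ ℕ.* (D ℕ.* μ) ℕ.+ D ℕ.* μ ℕ.* (D ℕ.* μ))
        eq₁ = solve-∀
        eq₂ : ∀ D μ → 4 ℕ.* (D ℕ.* D) ℕ.* (2 ℕ.* μ) ≡ D ℕ.* μ ℕ.* (8 ℕ.* D)
        eq₂ = solve-∀
        eq₃ : ∀ D′ μ → 4 ℕ.* D′ ℕ.* μ ℕ.* (8 ℕ.* D′) ≡ 4 ℕ.* (2 ℕ.* D′ ℕ.* (2 ℕ.* D′)) ℕ.* (2 ℕ.* μ)
        eq₃ = solve-∀
        eq₄ : ∀ D′ μ → (2 ℕ.* D′ ℕ.* (2 ℕ.* D′) ℕ.+ 2 ℕ.* (2 ℕ.* D′)) ℕ.* μ ≡ 4 ℕ.* D′ ℕ.* μ ℕ.* (D′ ℕ.+ 1)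
        eq₄ = solve-∀
        eq′ : suc i ℕ.+ d ≡ n
        eq′ = trans (sym (ℕ.+-suc i d)) eq
        IH : ι (D′ ℕ.+ 1) ≤ ι (8 ℕ.* D′) * Pr is-just (loop H B F k d (suc i) eq′)
        IH = loop-bound j d (suc i) eq′ (ℕ.m≤n⇒m≤1+n l≤i) (trans (sym (ℕ.+-suc i j)) i+j≡l+c)
        2≤D : 2 ℕ.≤ D
        2≤D = ℕ.m≤m*n 2 D′ {{ℕ.m^n≢0 2 j}}
        bound : ∀ s → ι ((D ℕ.* D ℕ.+ 2 ℕ.* D) ℕ.* μ ℕ.+ 2 ℕ.* (D ℕ.* μ) ℕ.* count s)
                    ≤ ι (4 ℕ.* (D ℕ.* D) ℕ.* p) * success s + ι (count s ℕ.* count s ℕ.+ D ℕ.* μ ℕ.* (D ℕ.* μ))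
        bound s@(h , α) with outcome (restrict ⟦ F ⟧ h α)
        ... | inside in-range |S|≡z = ι-weaken {N₁ = 4 ℕ.* (D ℕ.* D) ℕ.* count s}
          (ι-scale (4 ℕ.* (D ℕ.* D)) (ℚ.≤-reflexive (sym (success-inside s in-range |S|≡z))))
          (step-minorant D μ (count s) 2≤D (proj₁ in-range))
        -- The pay-off is that of the next iteration, where D is halved: 1/8 + 1/8D′ = 1/8 + 1/4D.
        -- The factor 4D′μ raises the denominator 8D′ to 8D²μ, and `amgm` discards the square (z -
        -- M)².
        ... | outside _ out = ι-weaken {N₁ = 4 ℕ.* D′ ℕ.* μ ℕ.* (D′ ℕ.+ 1)}
          (subst₂ (λ K x → ι (4 ℕ.* D′ ℕ.* μ ℕ.* (D′ ℕ.+ 1)) ≤ ι K * x)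
            (trans (eq₃ D′ μ) (cong (4 ℕ.* (D ℕ.* D) ℕ.*_) (sym pivot≡2μ)))
            (cong (Pr is-just) (sym (until-outside d i eq (sat (restrict ⟦ F ⟧ h α) (p ℕ.+ 1)) out)))
            (ι-scale (4 ℕ.* D′ ℕ.* μ) {D′ ℕ.+ 1} {8 ℕ.* D′} IH))
          (ℕ.+-mono-≤ (ℕ.≤-reflexive (eq₄ D′ μ)) (ℕ.≤-trans (amgm (D ℕ.* μ) (count s))
            (ℕ.≤-reflexive (ℕ.+-comm _ (count s ℕ.* count s)))))

    -- The two branches of the algorithm.

    pick-succeeds : ∀ S → 1 ℕ.≤ length S → Pr is-just (pick H B F k S) ≡ 1ℚ
    pick-succeeds S@(_ ∷ _) _ = 𝔼-const (uniform (just ∘ List.lookup S)) 1ℚ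

    -- Drops the surplus 1/8N from the bound of the first iteration.
    1/8-bound : ∀ N .{{_ : NonZero N}} x → ι (N ℕ.+ 1) ≤ ι (8 ℕ.* N) * x → (+ 1 / 8) ≤ x
    1/8-bound N x le = ℚ.*-cancelˡ-≤-pos (ι 8) {{ι-pos 8}} (ℚ.≤-trans (ℚ.≤-reflexive (trans (ι-*-inverse 8) (sym ι-1)))
      (ι-cancel N {1} {8} {x} {0} (begin
        ι (N ℕ.* 1 ℕ.+ 0)            ≤⟨ ι-mono-≤ (ℕ.≤-trans (ℕ.≤-reflexive (trans (ℕ.+-identityʳ _) (ℕ.*-identityʳ N)))
                                       (ℕ.m≤m+n N 1)) ⟩
        ι (N ℕ.+ 1)                  ≤⟨ le ⟩
        ι (8 ℕ.* N) * x              ≡⟨ cong (λ K → ι K * x) (ℕ.*-comm 8 N) ⟩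
        ι (N ℕ.* 8) * x              ≡⟨ ℚ.+-identityʳ _ ⟨
        ι (N ℕ.* 8) * x + 0ℚ         ≡⟨ cong (_+_ (ι (N ℕ.* 8) * x)) ι-0 ⟨
        ι (N ℕ.* 8) * x + ι 0        ∎)))
      where open ℚ.≤-Reasoning

    Pr-few : 1 ℕ.≤ # ⟦ F ⟧ → # ⟦ F ⟧ ℕ.≤ p → (+ 1 / 8) ≤ Pr is-just (UniWit H B F k)
    Pr-few 1≤# #≤p rewrite dec-true (length (sat ⟦ F ⟧ (p ℕ.+ 1)) ≤? p)
        (ℕ.≤-trans (ℕ.≤-reflexive (card ⟦ F ⟧ (p ℕ.+ 1))) (ℕ.≤-trans (ℕ.m⊓n≤n (p ℕ.+ 1) (# ⟦ F ⟧)) #≤p)) =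
      -- The choice from a nonempty set succeeds with probability 1, and 1/8 ≤ 1 holds by
      -- computation.
      ℚ.≤-trans (ℚ.≤ᵇ⇒≤ _) (ℚ.≤-reflexive (sym (pick-succeeds (sat ⟦ F ⟧ (p ℕ.+ 1))
        (ℕ.≤-trans (ℕ.⊓-glb (ℕ.m≤n+m 1 p) 1≤#) (ℕ.≤-reflexive (sym (card ⟦ F ⟧ (p ℕ.+ 1))))))))

    Pr-many : p < # ⟦ F ⟧ → Scale n k (# ⟦ F ⟧) → (+ 1 / 8) ≤ Pr is-just (UniWit H B F k)
    Pr-many p<# sc rewrite dec-false (length (sat ⟦ F ⟧ (p ℕ.+ 1)) ≤? p)
        (ℕ.<⇒≱ (ℕ.≤-trans (ℕ.⊓-glb (ℕ.≤-reflexive (ℕ.+-comm 1 p)) p<#) (ℕ.≤-reflexive (sym (card ⟦ F ⟧ (p ℕ.+ 1)))))) =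
      1/8-bound (2 ^ c) {{ℕ.m^n≢0 2 c}} (Pr is-just (loop H B F k (n ∸ l) l (ℕ.m+[n∸m]≡n (start-≤ n k))))
        -- The first iteration has i = l, so no hash bits are used, and c more are needed for the
        -- mean to fall to μ: D = 2ᶜ.
        (loop-bound sc c (n ∸ l) l (ℕ.m+[n∸m]≡n (start-≤ n k)) ℕ.≤-refl refl)
      where open Scale sc using (c)

open Probability

open import Data.Nat.Base using (_≤_; _<_; _^_)

theorem4 :
    (n k r : ℕ) → 1 ≤ k → 2 ≤ r → r ≤ 2 ^ n →
    (H : ∀ m → .(m ≤ n) → HashFamily n m r) (B : BoundedSAT n)
    (F : CNF n) → Satisfiable ⟦ F ⟧ → 2 ^ k < n →
    LogDifferenceIsInteger (# ⟦ F ⟧) k n →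
    (+ 1 ℚ./ 8) ℚ.≤ Pr is-just (UniWit H B F k)
theorem4 n k r 1≤k 2≤r r≤2ⁿ H B F sat-F 2ᵏ<n log with # ⟦ F ⟧ ℕ.≤? pivot n k
... | yes #≤p = Pr-few (Satisfiable⇒1≤# ⟦ F ⟧ sat-F) #≤p
  where open Analysis H B F k 2≤r r≤2ⁿ
... | no #≰p = Pr-many (ℕ.≰⇒> #≰p)
    (scale 1≤k (ℕ.≤-trans (ℕ.m^n>0 2 k) (ℕ.<⇒≤ 2ᵏ<n)) log (Vec.count≤n _ (allBits n)) (ℕ.≰⇒> #≰p))
  where open Analysis H B F k 2≤r r≤2ⁿ
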